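{- OGA-derivability of coded judgments is recursively enumerable; more precisely, there is a primitive recursive test $P:\mathbb N^2\to\{0,1\}$ such that, for all $p,j\in\mathbb N$, $P(p,j)=1$ if and only if $p$ is the code of a valid OGA proof containing the judgment with code $j$. Consequently $j$ is the code of an OGA-derivable judgment if and only if $P(p,j)=1$ for some $p$.
   Context: **Syntax.** Terms: $t::=v_i\mid\bot\mid\mathbf 0\mid\mathbf S t\mid t=t\mid\neg t\mid t\lor t\mid\lambda t\mid t\cdot t\mid\mathcal R\mid\mathcal A$ ($v_i$, $i\in\mathbb N$, de Bruijn variables; $\lambda$ is the only binder; application associates to the left). A term is well-formed (wf) if generated by this grammar. $\bot$ is a divergent constant, $\mathcal R$ the primitive recursor, $\mathcal A$ the universal quantifier. Abbreviations: $t\,\mathsf N$ is $t=t$; $t\,\mathsf B$ is $t\lor\neg t$; $t\ne u$ is $\neg(t=u)$; $t\land u$ is $\neg(\neg t\lor\neg u)$; $t\to u$ is $\neg t\lor u$; $\underline n=\mathbf S^n\mathbf 0$. $\uparrow$ shifts all free indices up by one; $b[t]$ is the $\beta$-instance substituting $t$ for the outermost bound variable of $b$; $[v\mapsto s]$ is capture-avoiding substitution for a free variable; $\mathrm{fv}$ is the set of free variables. **Head steps** $\triangleright$: $(\lambda b)\cdot t\triangleright b[t]$; $\mathcal R\cdot g\cdot h\cdot\mathbf 0\triangleright g$; $\mathcal R\cdot g\cdot h\cdot(\mathbf S\underline n)\triangleright h\cdot\underline n\cdot(\mathcal R\cdot g\cdot h\cdot\underline n)$; if $t\triangleright t'$ then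 $t\cdot u\triangleright t'\cdot u$. **Rules.** Judgments are $\Gamma\vdash c$, $\Gamma$ a finite set of wf terms, $c$ a wf term (all terms in rules are wf). A proof is a finite list of judgments each following from earlier entries by one rule; $\Gamma\vdash c$ is derivable if it occurs in a proof. Rules ("$\Rightarrow$" from premises to conclusion, "$\Leftrightarrow$" both directions; $\Gamma$ is the context of a judgment when none is shown): $\Gamma,c\vdash c$; $\Gamma\vdash c\Rightarrow\Gamma,a\vdash c$; $\Gamma\vdash a$ and $\Gamma,a\vdash c\Rightarrow\Gamma\vdash c$; $\Gamma\vdash c\Rightarrow[v\mapsto s]\Gamma\vdash[v\mapsto s]c$; $\vdash a\Leftrightarrow\ \vdash a=\underline1$; $\vdash\neg a\Leftrightarrow\ \vdash a=\underline0$; $\vdash\neg a,\ \vdash a\Rightarrow\ \vdash c$; $\vdash a\Leftrightarrow\ \vdash\neg\neg a$; $\vdash a\Rightarrow\ \vdash a\lor b$; $\vdash b\Rightarrow\ \vdash a\lor b$; $\vdash\neg a,\ \vdash\neg b\Rightarrow\ \vdash\neg(a\lor b)$; $\vdash a\lor b,\ \Gamma,a\vdash c,\ \Gamma,b\vdash c\Rightarrow\ \vdash c$; $\vdash\neg(a\lor b)\Rightarrow\ \vdash\neg a$; $\vdash\neg(a\lor b)\Rightarrow\ \vdash\neg b$; $\vdash a\,\mathsf N\Leftrightarrow\ \vdash a=a$; $\vdash a=b\Rightarrow\ \vdash b=a$; $\vdash a=b,\ \vdash[v\mapsto a]p\Rightarrow\ \vdash[v\mapsto b]p$; $\vdash a\ne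 b\Rightarrow\ \vdash b\ne a$; $\vdash a\,\mathsf N,\ \vdash b\,\mathsf N\Rightarrow\ \vdash(a=b)\,\mathsf B$; $\vdash(a=b)\,\mathsf B\Rightarrow\ \vdash(a\,\mathsf N)\land(b\,\mathsf N)$; $\vdash\mathbf 0\,\mathsf N$; $\vdash a\,\mathsf N\Leftrightarrow\ \vdash(\mathbf S a)\,\mathsf N$; $\vdash a\,\mathsf N\Rightarrow\ \vdash\mathbf S a\ne\mathbf 0$; $\vdash a\ne b\Leftrightarrow\ \vdash\mathbf S a\ne\mathbf S b$; $\vdash\mathbf S a=\mathbf S b\Rightarrow\ \vdash a=b$; $\vdash\bot\,\mathsf N\Rightarrow\ \vdash p$; induction: $\vdash[v_i\mapsto\mathbf 0]c$, $\ v_i\,\mathsf N,c,\Gamma\vdash[v_i\mapsto\mathbf S v_i]c$, $\ \vdash a\,\mathsf N\Rightarrow\ \vdash[v_i\mapsto a]c$ if $v_i\notin\mathrm{fv}(\Gamma)$; conversion, for $c\triangleright c'$: $\vdash c'\Rightarrow\ \vdash c$; $\vdash c\Rightarrow\ \vdash c'$; $\vdash\neg c\Rightarrow\ \vdash\neg c'$; $\vdash c'\,\mathsf N\Rightarrow\ \vdash c=c'$; $\vdash m\,\mathsf N,\ \vdash(h\cdot m\cdot(\mathcal R\cdot g\cdot h\cdot m))\,\mathsf N\Rightarrow\ \vdash\mathcal R\cdot g\cdot h\cdot(\mathbf S m)=h\cdot m\cdot(\mathcal R\cdot g\cdot h\cdot m)$; $v_0\,\mathsf N,\uparrow\Gamma\vdash\uparrow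 f\cdot v_0\Rightarrow\Gamma\vdash\mathcal A\cdot f$; $\vdash\mathcal A\cdot f,\ \vdash a\,\mathsf N\Rightarrow\ \vdash f\cdot a$; $\vdash\neg(f\cdot a),\ \vdash a\,\mathsf N\Rightarrow\ \vdash\neg(\mathcal A\cdot f)$; $\Gamma\vdash\neg(\mathcal A\cdot f)$ and $v_0\,\mathsf N,\neg(\uparrow f\cdot v_0),\uparrow\Gamma\vdash\uparrow c\Rightarrow\Gamma\vdash c$. These are the rules of RGA. OGA has these and the rule ATI: $\Gamma\vdash\mathcal A\cdot(\lambda((\uparrow u\cdot v_0)\,\mathsf B))\Rightarrow\Gamma\vdash(\mathcal A\cdot u)\,\mathsf B$. **Coding.** Fix a standard primitive recursive Gödel coding of terms, judgments (finite hypothesis set plus conclusion) and proofs by natural numbers; proof codes are codes of finite lists of judgments, annotated if desired with the rule, premise and instance data justifying each entry. -}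

module Defs where

open import Data.Bool.Base using (if_then_else_)
open import Data.Empty using (⊥)
open import Data.Fin.Base using (Fin)
open import Data.List.Base using (List; []; _∷_; [_]; map)
open import Data.List.Membership.Propositional using (_∈_)
open import Data.List.Membership.DecPropositional using (_∈?_)
open import Data.List.Relation.Binary.BagAndSetEquality using (_∼[_]_; set)
open import Data.List.Relation.Unary.All using (All)
open import Data.List.Relation.Unary.Any using (Any)
open import Data.Nat.Base using (ℕ; zero; suc; pred; _+_; _*_; _^_)
open import Data.Nat.Properties using (_≟_; <-cmp)
open import Data.Product.Base using (Σ-syntax; ∃-syntax; _×_; _,_)
open import Data.Sum.Base using (_⊎_)
open import Data.Vec.Base using (Vec; []; _∷_; lookup)
open import Function.Bundles using (_⇔_)
open import Relation.Binary.Definitions using (tri<; tri≈; tri>)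
open import Relation.Binary.PropositionalEquality.Core using (_≡_)
open import Relation.Nullary.Decidable.Core using (does)
open import Relation.Nullary.Negation.Core using (¬_)

------------------------------------------------------------------------
-- Primitive recursive functions

data PR : ℕ → Set where
  zero : PR 0
  suc  : PR 1
  proj : ∀ {n} → Fin n → PR n
  comp : ∀ {m n} → PR m → Vec (PR n) m → PR n
  rec  : ∀ {n} → PR n → PR (suc (suc n)) → PR (suc n)

mutual
  eval : ∀ {n} → PR n → Vec ℕ n → ℕ
  eval zero       []           = 0
  eval suc        (x ∷ [])     = suc x
  eval (proj i)   xs           = lookup xs i
  eval (comp f g) xs           = eval f (evals g xs)
  eval (rec g h)  (zero ∷ xs)  = eval g xs
  eval (rec g h)  (suc n ∷ xs) = eval h (n ∷ eval (rec g h) (n ∷ xs) ∷ xs)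

  evals : ∀ {m n} → Vec (PR n) m → Vec ℕ n → Vec ℕ m
  evals []       xs = []
  evals (f ∷ fs) xs = eval f xs ∷ evals fs xs

PrimitiveRecursive₂ : (ℕ → ℕ → ℕ) → Set
PrimitiveRecursive₂ f = Σ[ e ∈ PR 2 ] (∀ x y → eval e (x ∷ y ∷ []) ≡ f x y)

-- Projections of primitive recursive relations, the relation being given by
-- the points at which a primitive recursive function takes the value 1.
RecursivelyEnumerable : (ℕ → Set) → Set
RecursivelyEnumerable S =
  Σ[ R ∈ (ℕ → ℕ → ℕ) ] (PrimitiveRecursive₂ R × (∀ j → S j ⇔ (∃[ x ] R x j ≡ 1)))

------------------------------------------------------------------------
-- Syntax

infixl 9 _·_
infixr 8 𝐒_ ∼_
infix  7 _≐_ _≠_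
infix  6 _𝐍 _𝐁
infixr 5 _∨_ _∧_
infixr 4 ƛ_

-- Well-formed terms, with de Bruijn indices.
data Term : Set where
  v   : ℕ → Term
  bot : Term
  𝟎   : Term
  𝐒_  : Term → Term
  _≐_ : Term → Term → Term
  ∼_  : Term → Term
  _∨_ : Term → Term → Term
  ƛ_  : Term → Term
  _·_ : Term → Term → Term
  𝓡   : Term
  𝓐   : Term

_𝐍 _𝐁 : Term → Term
t 𝐍 = t ≐ t
t 𝐁 = t ∨ (∼ t)

_≠_ _∧_ : Term → Term → Term
t ≠ u = ∼ (t ≐ u)
t ∧ u = ∼ ((∼ t) ∨ (∼ u))

num : ℕ → Term
num zero    = 𝟎
num (suc n) = 𝐒 num n

-- Increments the indices that are ≥ k.
shiftFrom : ℕ → Term → Term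
shiftFrom k (v i) with <-cmp i k
... | tri< _ _ _ = v i
... | tri≈ _ _ _ = v (suc i)
... | tri> _ _ _ = v (suc i)
shiftFrom k bot     = bot
shiftFrom k 𝟎       = 𝟎
shiftFrom k (𝐒 t)   = 𝐒 shiftFrom k t
shiftFrom k (t ≐ u) = shiftFrom k t ≐ shiftFrom k u
shiftFrom k (∼ t)   = ∼ shiftFrom k t
shiftFrom k (t ∨ u) = shiftFrom k t ∨ shiftFrom k u
shiftFrom k (ƛ t)   = ƛ shiftFrom (suc k) t
shiftFrom k (t · u) = shiftFrom k t · shiftFrom k u
shiftFrom k 𝓡       = 𝓡
shiftFrom k 𝓐       = 𝓐

↑_ : Term → Term
↑ t = shiftFrom 0 t

infixr 10 ↑_

-- Replaces the free variable i by s; all other free indices are kept.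
[_↦_]_ : ℕ → Term → Term → Term
[ i ↦ s ] v j     = if does (j ≟ i) then s else v j
[ i ↦ s ] bot     = bot
[ i ↦ s ] 𝟎       = 𝟎
[ i ↦ s ] (𝐒 t)   = 𝐒 ([ i ↦ s ] t)
[ i ↦ s ] (t ≐ u) = ([ i ↦ s ] t) ≐ ([ i ↦ s ] u)
[ i ↦ s ] (∼ t)   = ∼ ([ i ↦ s ] t)
[ i ↦ s ] (t ∨ u) = ([ i ↦ s ] t) ∨ ([ i ↦ s ] u)
[ i ↦ s ] (ƛ t)   = ƛ ([ suc i ↦ ↑ s ] t)
[ i ↦ s ] (t · u) = ([ i ↦ s ] t) · ([ i ↦ s ] u)
[ i ↦ s ] 𝓡       = 𝓡
[ i ↦ s ] 𝓐       = 𝓐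

-- Replaces index k by s and decrements the indices above k, as is needed
-- when the binder of k disappears.
inst : ℕ → Term → Term → Term
inst k s (v i) with <-cmp i k
... | tri< _ _ _ = v i
... | tri≈ _ _ _ = s
... | tri> _ _ _ = v (pred i)
inst k s bot     = bot
inst k s 𝟎       = 𝟎
inst k s (𝐒 t)   = 𝐒 inst k s t
inst k s (t ≐ u) = inst k s t ≐ inst k s u
inst k s (∼ t)   = ∼ inst k s t
inst k s (t ∨ u) = inst k s t ∨ inst k s u
inst k s (ƛ t)   = ƛ inst (suc k) (↑ s) t
inst k s (t · u) = inst k s t · inst k s u
inst k s 𝓡       = 𝓡
inst k s 𝓐       = 𝓐

_[_]ᵝ : Term → Term → Term
b [ t ]ᵝ = inst 0 t b

infix 3 _∈fv_

_∈fv_ : ℕ → Term → Set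
i ∈fv v j     = i ≡ j
i ∈fv bot     = ⊥
i ∈fv 𝟎       = ⊥
i ∈fv (𝐒 t)   = i ∈fv t
i ∈fv (t ≐ u) = (i ∈fv t) ⊎ (i ∈fv u)
i ∈fv (∼ t)   = i ∈fv t
i ∈fv (t ∨ u) = (i ∈fv t) ⊎ (i ∈fv u)
i ∈fv (ƛ t)   = suc i ∈fv t
i ∈fv (t · u) = (i ∈fv t) ⊎ (i ∈fv u)
i ∈fv 𝓡       = ⊥
i ∈fv 𝓐       = ⊥

------------------------------------------------------------------------
-- Head steps

infix 3 _▷_

data _▷_ : Term → Term → Set where
  β   : ∀ b t → (ƛ b) · t ▷ b [ t ]ᵝ
  𝓡𝟎  : ∀ g h → 𝓡 · g · h · 𝟎 ▷ g
  𝓡𝐒  : ∀ g h n → 𝓡 · g · h · (𝐒 num n) ▷ h · num n · (𝓡 · g · h · num n)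
  app : ∀ {t t′} u → t ▷ t′ → t · u ▷ t′ · u

------------------------------------------------------------------------
-- Judgments

infix 3 _⊢_ _≈_

-- A finite set of hypotheses is a list considered up to set equality.
Ctx : Set
Ctx = List Term

data Judgment : Set where
  _⊢_ : Ctx → Term → Judgment

_≈_ : Judgment → Judgment → Set
(Γ ⊢ c) ≈ (Δ ⊢ d) = (Γ ∼[ set ] Δ) × (c ≡ d)

------------------------------------------------------------------------
-- Rules of OGA

infix 2 _⟹_

-- Js ⟹ J is the type of rule instances with premises Js and conclusion J.
-- The two directions of a bidirectional rule are separate constructors.
data _⟹_ : List Judgment → Judgment → Set where

  hyp    : ∀ Γ c → [] ⟹ (c ∷ Γ ⊢ c)
  weak   : ∀ Γ a c → [ Γ ⊢ c ] ⟹ (a ∷ Γ ⊢ c)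
  cut    : ∀ Γ a c → (Γ ⊢ a) ∷ (a ∷ Γ ⊢ c) ∷ [] ⟹ (Γ ⊢ c)
  sub    : ∀ Γ c i s → [ Γ ⊢ c ] ⟹ (map ([ i ↦ s ]_) Γ ⊢ [ i ↦ s ] c)

  =1I    : ∀ Γ a → [ Γ ⊢ a ] ⟹ (Γ ⊢ a ≐ num 1)
  =1E    : ∀ Γ a → [ Γ ⊢ a ≐ num 1 ] ⟹ (Γ ⊢ a)
  =0I    : ∀ Γ a → [ Γ ⊢ ∼ a ] ⟹ (Γ ⊢ a ≐ num 0)
  =0E    : ∀ Γ a → [ Γ ⊢ a ≐ num 0 ] ⟹ (Γ ⊢ ∼ a)

  ∼E     : ∀ Γ a c → (Γ ⊢ ∼ a) ∷ (Γ ⊢ a) ∷ [] ⟹ (Γ ⊢ c)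
  ∼∼I    : ∀ Γ a → [ Γ ⊢ a ] ⟹ (Γ ⊢ ∼ ∼ a)
  ∼∼E    : ∀ Γ a → [ Γ ⊢ ∼ ∼ a ] ⟹ (Γ ⊢ a)

  ∨I₁    : ∀ Γ a b → [ Γ ⊢ a ] ⟹ (Γ ⊢ a ∨ b)
  ∨I₂    : ∀ Γ a b → [ Γ ⊢ b ] ⟹ (Γ ⊢ a ∨ b)
  ∼∨I    : ∀ Γ a b → (Γ ⊢ ∼ a) ∷ (Γ ⊢ ∼ b) ∷ [] ⟹ (Γ ⊢ ∼ (a ∨ b))
  ∨E     : ∀ Γ a b c →
           (Γ ⊢ a ∨ b) ∷ (a ∷ Γ ⊢ c) ∷ (b ∷ Γ ⊢ c) ∷ [] ⟹ (Γ ⊢ c)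
  ∼∨E₁   : ∀ Γ a b → [ Γ ⊢ ∼ (a ∨ b) ] ⟹ (Γ ⊢ ∼ a)
  ∼∨E₂   : ∀ Γ a b → [ Γ ⊢ ∼ (a ∨ b) ] ⟹ (Γ ⊢ ∼ b)

  𝐍⇒=    : ∀ Γ a → [ Γ ⊢ a 𝐍 ] ⟹ (Γ ⊢ a ≐ a)
  =⇒𝐍    : ∀ Γ a → [ Γ ⊢ a ≐ a ] ⟹ (Γ ⊢ a 𝐍)
  =sym   : ∀ Γ a b → [ Γ ⊢ a ≐ b ] ⟹ (Γ ⊢ b ≐ a)
  =subst : ∀ Γ a b i p →
           (Γ ⊢ a ≐ b) ∷ (Γ ⊢ [ i ↦ a ] p) ∷ [] ⟹ (Γ ⊢ [ i ↦ b ] p)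
  ≠sym   : ∀ Γ a b → [ Γ ⊢ a ≠ b ] ⟹ (Γ ⊢ b ≠ a)
  =𝐁I    : ∀ Γ a b → (Γ ⊢ a 𝐍) ∷ (Γ ⊢ b 𝐍) ∷ [] ⟹ (Γ ⊢ (a ≐ b) 𝐁)
  =𝐁E    : ∀ Γ a b → [ Γ ⊢ (a ≐ b) 𝐁 ] ⟹ (Γ ⊢ (a 𝐍) ∧ (b 𝐍))

  𝟎𝐍     : ∀ Γ → [] ⟹ (Γ ⊢ 𝟎 𝐍)
  𝐒𝐍I    : ∀ Γ a → [ Γ ⊢ a 𝐍 ] ⟹ (Γ ⊢ (𝐒 a) 𝐍)
  𝐒𝐍E    : ∀ Γ a → [ Γ ⊢ (𝐒 a) 𝐍 ] ⟹ (Γ ⊢ a 𝐍)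
  𝐒≠𝟎    : ∀ Γ a → [ Γ ⊢ a 𝐍 ] ⟹ (Γ ⊢ 𝐒 a ≠ 𝟎)
  𝐒≠I    : ∀ Γ a b → [ Γ ⊢ a ≠ b ] ⟹ (Γ ⊢ 𝐒 a ≠ 𝐒 b)
  𝐒≠E    : ∀ Γ a b → [ Γ ⊢ 𝐒 a ≠ 𝐒 b ] ⟹ (Γ ⊢ a ≠ b)
  𝐒=E    : ∀ Γ a b → [ Γ ⊢ 𝐒 a ≐ 𝐒 b ] ⟹ (Γ ⊢ a ≐ b)
  bot𝐍E  : ∀ Γ p → [ Γ ⊢ bot 𝐍 ] ⟹ (Γ ⊢ p)

  ind    : ∀ Γ c i a → All (λ t → ¬ (i ∈fv t)) Γ →
           (Γ ⊢ [ i ↦ 𝟎 ] c) ∷ (v i 𝐍 ∷ c ∷ Γ ⊢ [ i ↦ 𝐒 v i ] c) ∷ (Γ ⊢ a 𝐍) ∷ []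
             ⟹ (Γ ⊢ [ i ↦ a ] c)

  conv⁻  : ∀ Γ c c′ → c ▷ c′ → [ Γ ⊢ c′ ] ⟹ (Γ ⊢ c)
  conv⁺  : ∀ Γ c c′ → c ▷ c′ → [ Γ ⊢ c ] ⟹ (Γ ⊢ c′)
  conv∼  : ∀ Γ c c′ → c ▷ c′ → [ Γ ⊢ ∼ c ] ⟹ (Γ ⊢ ∼ c′)
  conv=  : ∀ Γ c c′ → c ▷ c′ → [ Γ ⊢ c′ 𝐍 ] ⟹ (Γ ⊢ c ≐ c′)

  𝓡rec   : ∀ Γ g h m →
           (Γ ⊢ m 𝐍) ∷ (Γ ⊢ (h · m · (𝓡 · g · h · m)) 𝐍) ∷ []
             ⟹ (Γ ⊢ 𝓡 · g · h · (𝐒 m) ≐ h · m · (𝓡 · g · h · m))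

  𝓐I     : ∀ Γ f → [ v 0 𝐍 ∷ map ↑_ Γ ⊢ ↑ f · v 0 ] ⟹ (Γ ⊢ 𝓐 · f)
  𝓐E     : ∀ Γ f a → (Γ ⊢ 𝓐 · f) ∷ (Γ ⊢ a 𝐍) ∷ [] ⟹ (Γ ⊢ f · a)
  ∼𝓐I    : ∀ Γ f a → (Γ ⊢ ∼ (f · a)) ∷ (Γ ⊢ a 𝐍) ∷ [] ⟹ (Γ ⊢ ∼ (𝓐 · f))
  ∼𝓐E    : ∀ Γ f c →
           (Γ ⊢ ∼ (𝓐 · f)) ∷ (v 0 𝐍 ∷ ∼ (↑ f · v 0) ∷ map ↑_ Γ ⊢ ↑ c) ∷ []
             ⟹ (Γ ⊢ c)

  -- The only rule of OGA that is not one of RGA.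
  ATI    : ∀ Γ u → [ Γ ⊢ 𝓐 · (ƛ ((↑ u · v 0) 𝐁)) ] ⟹ (Γ ⊢ (𝓐 · u) 𝐁)

------------------------------------------------------------------------
-- Proofs

infix 3 _occursIn_

_occursIn_ : Judgment → List Judgment → Set
J occursIn Js = Any (J ≈_) Js

-- Proof Js: the list Js, with its latest entry first, is a valid proof;
-- every entry carries the rule instance that justifies it.
data Proof : List Judgment → Set where
  []   : Proof []
  step : ∀ {Js Ps C} → Proof Js →
         (J : Judgment) (r : Ps ⟹ C) →
         J ≈ C → All (_occursIn Js) Ps → Proof (J ∷ Js)

Derivable : Judgment → Set
Derivable J = ∃[ Js ] (Proof Js × J occursIn Js)

------------------------------------------------------------------------
-- Coding

-- A Cantor-style injective pairing with values above both arguments. It is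
-- opaque only to keep the type checker from unfolding codes.
opaque
  ⟨_,_⟩ : ℕ → ℕ → ℕ
  ⟨ x , y ⟩ = suc ((x + y) * (x + y) + x)

codeList : List ℕ → ℕ
codeList []       = 0
codeList (x ∷ xs) = ⟨ x , codeList xs ⟩

-- Ackermann code of the finite set of elements of the list: the sum of
-- 2 ^ x over its distinct elements x.
codeSet : List ℕ → ℕ
codeSet []       = 0
codeSet (x ∷ xs) =
  if does (_∈?_ _≟_ x xs) then codeSet xs else 2 ^ x + codeSet xs

⌜_⌝ : Term → ℕ
⌜ v i ⌝   = ⟨ 0 , i ⟩
⌜ bot ⌝   = ⟨ 1 , 0 ⟩
⌜ 𝟎 ⌝     = ⟨ 2 , 0 ⟩
⌜ 𝐒 t ⌝   = ⟨ 3 , ⌜ t ⌝ ⟩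
⌜ t ≐ u ⌝ = ⟨ 4 , ⟨ ⌜ t ⌝ , ⌜ u ⌝ ⟩ ⟩
⌜ ∼ t ⌝   = ⟨ 5 , ⌜ t ⌝ ⟩
⌜ t ∨ u ⌝ = ⟨ 6 , ⟨ ⌜ t ⌝ , ⌜ u ⌝ ⟩ ⟩
⌜ ƛ t ⌝   = ⟨ 7 , ⌜ t ⌝ ⟩
⌜ t · u ⌝ = ⟨ 8 , ⟨ ⌜ t ⌝ , ⌜ u ⌝ ⟩ ⟩
⌜ 𝓡 ⌝     = ⟨ 9 , 0 ⟩
⌜ 𝓐 ⌝     = ⟨ 10 , 0 ⟩

⌜_⌝ᶜ : Ctx → ℕ
⌜ Γ ⌝ᶜ = codeSet (map ⌜_⌝ Γ)

⌜_⌝ʲ : Judgment → ℕ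
⌜ Γ ⊢ c ⌝ʲ = ⟨ ⌜ Γ ⌝ᶜ , ⌜ c ⌝ ⟩

-- The annotation recorded for a rule instance: a tag naming the rule,
-- followed by the context, terms and variable it is instantiated with.
annotation : ∀ {Js J} → Js ⟹ J → List ℕ
annotation (hyp Γ c)          = 0  ∷ ⌜ Γ ⌝ᶜ ∷ ⌜ c ⌝ ∷ []
annotation (weak Γ a c)       = 1  ∷ ⌜ Γ ⌝ᶜ ∷ ⌜ a ⌝ ∷ ⌜ c ⌝ ∷ []
annotation (cut Γ a c)        = 2  ∷ ⌜ Γ ⌝ᶜ ∷ ⌜ a ⌝ ∷ ⌜ c ⌝ ∷ []
annotation (sub Γ c i s)      = 3  ∷ ⌜ Γ ⌝ᶜ ∷ ⌜ c ⌝ ∷ i ∷ ⌜ s ⌝ ∷ []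
annotation (=1I Γ a)          = 4  ∷ ⌜ Γ ⌝ᶜ ∷ ⌜ a ⌝ ∷ []
annotation (=1E Γ a)          = 5  ∷ ⌜ Γ ⌝ᶜ ∷ ⌜ a ⌝ ∷ []
annotation (=0I Γ a)          = 6  ∷ ⌜ Γ ⌝ᶜ ∷ ⌜ a ⌝ ∷ []
annotation (=0E Γ a)          = 7  ∷ ⌜ Γ ⌝ᶜ ∷ ⌜ a ⌝ ∷ []
annotation (∼E Γ a c)         = 8  ∷ ⌜ Γ ⌝ᶜ ∷ ⌜ a ⌝ ∷ ⌜ c ⌝ ∷ []
annotation (∼∼I Γ a)          = 9  ∷ ⌜ Γ ⌝ᶜ ∷ ⌜ a ⌝ ∷ []
annotation (∼∼E Γ a)          = 10 ∷ ⌜ Γ ⌝ᶜ ∷ ⌜ a ⌝ ∷ []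
annotation (∨I₁ Γ a b)        = 11 ∷ ⌜ Γ ⌝ᶜ ∷ ⌜ a ⌝ ∷ ⌜ b ⌝ ∷ []
annotation (∨I₂ Γ a b)        = 12 ∷ ⌜ Γ ⌝ᶜ ∷ ⌜ a ⌝ ∷ ⌜ b ⌝ ∷ []
annotation (∼∨I Γ a b)        = 13 ∷ ⌜ Γ ⌝ᶜ ∷ ⌜ a ⌝ ∷ ⌜ b ⌝ ∷ []
annotation (∨E Γ a b c)       = 14 ∷ ⌜ Γ ⌝ᶜ ∷ ⌜ a ⌝ ∷ ⌜ b ⌝ ∷ ⌜ c ⌝ ∷ []
annotation (∼∨E₁ Γ a b)       = 15 ∷ ⌜ Γ ⌝ᶜ ∷ ⌜ a ⌝ ∷ ⌜ b ⌝ ∷ []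
annotation (∼∨E₂ Γ a b)       = 16 ∷ ⌜ Γ ⌝ᶜ ∷ ⌜ a ⌝ ∷ ⌜ b ⌝ ∷ []
annotation (𝐍⇒= Γ a)          = 17 ∷ ⌜ Γ ⌝ᶜ ∷ ⌜ a ⌝ ∷ []
annotation (=⇒𝐍 Γ a)          = 18 ∷ ⌜ Γ ⌝ᶜ ∷ ⌜ a ⌝ ∷ []
annotation (=sym Γ a b)       = 19 ∷ ⌜ Γ ⌝ᶜ ∷ ⌜ a ⌝ ∷ ⌜ b ⌝ ∷ []
annotation (=subst Γ a b i p) = 20 ∷ ⌜ Γ ⌝ᶜ ∷ ⌜ a ⌝ ∷ ⌜ b ⌝ ∷ i ∷ ⌜ p ⌝ ∷ []
annotation (≠sym Γ a b)       = 21 ∷ ⌜ Γ ⌝ᶜ ∷ ⌜ a ⌝ ∷ ⌜ b ⌝ ∷ []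
annotation (=𝐁I Γ a b)        = 22 ∷ ⌜ Γ ⌝ᶜ ∷ ⌜ a ⌝ ∷ ⌜ b ⌝ ∷ []
annotation (=𝐁E Γ a b)        = 23 ∷ ⌜ Γ ⌝ᶜ ∷ ⌜ a ⌝ ∷ ⌜ b ⌝ ∷ []
annotation (𝟎𝐍 Γ)             = 24 ∷ ⌜ Γ ⌝ᶜ ∷ []
annotation (𝐒𝐍I Γ a)          = 25 ∷ ⌜ Γ ⌝ᶜ ∷ ⌜ a ⌝ ∷ []
annotation (𝐒𝐍E Γ a)          = 26 ∷ ⌜ Γ ⌝ᶜ ∷ ⌜ a ⌝ ∷ []
annotation (𝐒≠𝟎 Γ a)          = 27 ∷ ⌜ Γ ⌝ᶜ ∷ ⌜ a ⌝ ∷ []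
annotation (𝐒≠I Γ a b)        = 28 ∷ ⌜ Γ ⌝ᶜ ∷ ⌜ a ⌝ ∷ ⌜ b ⌝ ∷ []
annotation (𝐒≠E Γ a b)        = 29 ∷ ⌜ Γ ⌝ᶜ ∷ ⌜ a ⌝ ∷ ⌜ b ⌝ ∷ []
annotation (𝐒=E Γ a b)        = 30 ∷ ⌜ Γ ⌝ᶜ ∷ ⌜ a ⌝ ∷ ⌜ b ⌝ ∷ []
annotation (bot𝐍E Γ p)        = 31 ∷ ⌜ Γ ⌝ᶜ ∷ ⌜ p ⌝ ∷ []
annotation (ind Γ c i a _)    = 32 ∷ ⌜ Γ ⌝ᶜ ∷ ⌜ c ⌝ ∷ i ∷ ⌜ a ⌝ ∷ []
annotation (conv⁻ Γ c c′ _)   = 33 ∷ ⌜ Γ ⌝ᶜ ∷ ⌜ c ⌝ ∷ ⌜ c′ ⌝ ∷ []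
annotation (conv⁺ Γ c c′ _)   = 34 ∷ ⌜ Γ ⌝ᶜ ∷ ⌜ c ⌝ ∷ ⌜ c′ ⌝ ∷ []
annotation (conv∼ Γ c c′ _)   = 35 ∷ ⌜ Γ ⌝ᶜ ∷ ⌜ c ⌝ ∷ ⌜ c′ ⌝ ∷ []
annotation (conv= Γ c c′ _)   = 36 ∷ ⌜ Γ ⌝ᶜ ∷ ⌜ c ⌝ ∷ ⌜ c′ ⌝ ∷ []
annotation (𝓡rec Γ g h m)     = 37 ∷ ⌜ Γ ⌝ᶜ ∷ ⌜ g ⌝ ∷ ⌜ h ⌝ ∷ ⌜ m ⌝ ∷ []
annotation (𝓐I Γ f)           = 38 ∷ ⌜ Γ ⌝ᶜ ∷ ⌜ f ⌝ ∷ []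
annotation (𝓐E Γ f a)         = 39 ∷ ⌜ Γ ⌝ᶜ ∷ ⌜ f ⌝ ∷ ⌜ a ⌝ ∷ []
annotation (∼𝓐I Γ f a)        = 40 ∷ ⌜ Γ ⌝ᶜ ∷ ⌜ f ⌝ ∷ ⌜ a ⌝ ∷ []
annotation (∼𝓐E Γ f c)        = 41 ∷ ⌜ Γ ⌝ᶜ ∷ ⌜ f ⌝ ∷ ⌜ c ⌝ ∷ []
annotation (ATI Γ u)          = 42 ∷ ⌜ Γ ⌝ᶜ ∷ ⌜ u ⌝ ∷ []

entries : ∀ {Js} → Proof Js → List ℕ
entries []               = []
entries (step π J r _ _) = ⟨ ⌜ J ⌝ʲ , codeList (annotation r) ⟩ ∷ entries π

⌜_⌝ᵖ : ∀ {Js} → Proof Js → ℕ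
⌜ π ⌝ᵖ = codeList (entries π)

-- p is the code of a valid proof containing the judgment with code j.
ProvesCode : ℕ → ℕ → Set
ProvesCode p j =
  ∃[ Js ] Σ[ π ∈ Proof Js ] (⌜ π ⌝ᵖ ≡ p × (∃[ J ] (⌜ J ⌝ʲ ≡ j × J occursIn Js)))

DerivableCode : ℕ → Set
DerivableCode j = ∃[ J ] (⌜ J ⌝ʲ ≡ j × Derivable J)

{-# OPTIONS --safe #-}
-- Codes are nested pairs, so a function defined by recursion on terms becomes a
-- course-of-values recursion on codes. Below a binder the number d of binders
-- passed grows, but for a term with code n the index ⟨ n , n + d ⟩ still
-- decreases. Finite sets are binary numerals, every number is the code of one,
-- and images of sets are found by bounded search. Each rule is an instance of a
-- schema with a reading in terms and a matching one in codes. As a proof code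
-- records the instance data of every entry, checking it takes only comparisons
-- and bounded searches.
module Submission where

open import Defs
open import Data.Bool.Base using (Bool; true; false; if_then_else_; not; T) renaming (_∧_ to _&&_; _∨_ to _||_)
open import Data.Bool.ListAction using (all; any)
open import Data.Bool.Properties using (T-∧; T-∨; T-≡; not-involutive)
open import Data.Fin using (Fin; zero; suc; #_)
open import Data.List.Base using (List; []; _∷_; map; replicate)
import Data.List.Base as List
open import Data.List.Membership.Propositional using (_∈_; lose; find)
open import Data.List.Membership.DecPropositional using (_∈?_)
open import Data.List.Membership.Propositional.Properties using (∈-map⁺; ∈-map⁻; ∈-lookup)
open import Data.List.Properties using (map-∘; map-cong)
open import Data.List.Relation.Binary.BagAndSetEquality using (_∼[_]_; set) renaming (map-cong to ∼-map-cong)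
open import Data.List.Relation.Unary.All using (All; []; _∷_)
import Data.List.Relation.Unary.All as All
import Data.List.Relation.Unary.All.Properties as All
open import Data.List.Relation.Unary.Any using (Any; here; there)
import Data.List.Relation.Unary.Any.Properties as Any
open import Data.Nat.Base
open import Data.Nat.Induction using (<-rec)
open import Data.Nat.Properties
open import Data.Product.Base using (Σ-syntax; ∃-syntax; ∃₂; _×_; _,_; proj₁; proj₂)
open import Data.Sum.Base using (_⊎_; inj₁; inj₂)
import Data.Sum.Base as Sum
open import Data.Unit.Base using (⊤)
open import Data.Vec.Base using (Vec; []; _∷_; lookup; head; tail; tabulate)
open import Data.Vec.Properties using (tabulate∘lookup)
open import Function.Base using (_∘_; id; case_of_)
open import Function.Bundles using (_⇔_; mk⇔; Equivalence)
open import Relation.Binary.Definitions using (tri<; tri≈; tri>)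
open import Relation.Binary.PropositionalEquality hiding ([_])
open import Relation.Nullary.Decidable.Core using (yes; no)
open import Relation.Nullary.Negation using (¬_; contradiction)

open Equivalence using (to; from)

-- The test has to be exact on all numbers, not only on codes. Pairing is not onto, so a number is
-- accepted as a pair or as an annotation only if reassembling it from its projections gives it
-- back, and codes of terms are the fixed points of a traversal that always returns a code. The code
-- of a context determines it only up to set equality. Proofs compare judgments up to the same
-- relation, so a proof rebuilt from its code may use other lists as contexts and still have that
-- code. Per rule only two things remain to be checked: its schema yields an instance with the
-- recorded annotation, and every instance arises from the schema. Agreement of the two readings and
-- primitive recursiveness are proved per expression former. All functions are ordinary functions on
-- numbers; their programs are assembled by closure lemmas.

natrec : ∀ {a} {A : Set a} → A → (ℕ → A → A) → ℕ → A
natrec z s zero    = z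
natrec z s (suc k) = s k (natrec z s k)

iter : ∀ {a} {A : Set a} → (A → A) → A → ℕ → A
iter f x = natrec x (λ _ → f)

iter-comm : ∀ {a} {A : Set a} (f : A → A) x k → iter f (f x) k ≡ f (iter f x k)
iter-comm f x zero    = refl
iter-comm f x (suc k) = cong f (iter-comm f x k)

χ : Bool → ℕ
χ true  = 1
χ false = 0

allBelow anyBelow : (ℕ → Bool) → ℕ → Bool
allBelow f = natrec true  (λ i b → f i && b)
anyBelow f = natrec false (λ i b → f i || b)

-- Closure properties of the primitive recursive functions

record Prim {n} (f : Vec ℕ n → ℕ) : Set where
  constructor prim
  field
    code    : PR n
    correct : ∀ xs → eval code xs ≡ f xs

record PrimB {n} (b : Vec ℕ n → Bool) : Set where
  constructor primB
  field
    indicator : Prim (λ xs → χ (b xs))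

open PrimB

-- Stated under an arbitrary argument `g`, so that applications nest directly, without explicit
-- compositions or projections.
Prim₁ : (ℕ → ℕ) → Set
Prim₁ f = ∀ {n} {g : Vec ℕ n → ℕ} → Prim g → Prim (λ xs → f (g xs))

Prim₂ : (ℕ → ℕ → ℕ) → Set
Prim₂ f = ∀ {n} {g h : Vec ℕ n → ℕ} → Prim g → Prim h → Prim (λ xs → f (g xs) (h xs))

Prim₃ : (ℕ → ℕ → ℕ → ℕ) → Set
Prim₃ f = ∀ {n} {g h k : Vec ℕ n → ℕ} → Prim g → Prim h → Prim k →
          Prim (λ xs → f (g xs) (h xs) (k xs))

PrimB₂ : (ℕ → ℕ → Bool) → Set
PrimB₂ f = ∀ {n} {g h : Vec ℕ n → ℕ} → Prim g → Prim h → PrimB (λ xs → f (g xs) (h xs))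

≗-prim : ∀ {n} {f g : Vec ℕ n → ℕ} → f ≗ g → Prim f → Prim g
≗-prim eq (prim c cc) = prim c λ xs → trans (cc xs) (eq xs)

evals-tabulate : ∀ {m n} (ys : Fin m → PR n) (f : Fin m → ℕ) xs →
                 (∀ i → eval (ys i) xs ≡ f i) → evals (tabulate ys) xs ≡ tabulate f
evals-tabulate {zero}  ys f xs eq = refl
evals-tabulate {suc m} ys f xs eq =
  cong₂ _∷_ (eq zero) (evals-tabulate (ys ∘ suc) (f ∘ suc) xs (eq ∘ suc))

evals-proj : ∀ {n} (xs : Vec ℕ n) → evals (tabulate proj) xs ≡ xs
evals-proj xs = trans (evals-tabulate proj (lookup xs) xs (λ _ → refl)) (tabulate∘lookup xs)

-- Each component of `σ xs` is a component of `xs`, so composing with projections suffices. Only the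
-- lookups of `σ` matter, which allows a `σ` built from `head` and `tail`.
reindex : ∀ {m n} (ρ : Fin m → Fin n) {σ : Vec ℕ n → Vec ℕ m} →
          (∀ xs i → lookup xs (ρ i) ≡ lookup (σ xs) i) →
          ∀ {f : Vec ℕ m → ℕ} → Prim f → Prim (f ∘ σ)
reindex ρ {σ} eq (prim c cc) = prim (comp c (tabulate (proj ∘ ρ))) λ xs →
  trans (cong (eval c) (trans (evals-tabulate (proj ∘ ρ) (lookup (σ xs)) xs (eq xs))
                              (tabulate∘lookup (σ xs))))
        (cc (σ xs))

wk : ∀ {n} {f : Vec ℕ n → ℕ} → Prim f → Prim {suc n} (λ xs → f (tail xs))
wk = reindex suc λ { (x ∷ xs) i → refl }

var₀ : ∀ {n} → Prim {suc n} head
var₀ = prim (proj zero) λ { (x ∷ xs) → refl }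

var₁ : ∀ {n} → Prim {2 + n} (λ xs → head (tail xs))
var₁ = wk var₀

suc-prim : Prim₁ suc
suc-prim (prim c cc) = prim (comp suc (c ∷ [])) λ xs → cong suc (cc xs)

const-prim : ∀ {n} k → Prim {n} (λ _ → k)
const-prim zero    = prim (comp zero []) λ _ → refl
const-prim (suc k) = suc-prim (const-prim k)

natrec-prim : ∀ {n} {z : Vec ℕ n → ℕ} {s : Vec ℕ (2 + n) → ℕ} {k : Vec ℕ n → ℕ} →
              Prim z → Prim s → Prim k →
              Prim (λ xs → natrec (z xs) (λ i r → s (i ∷ r ∷ xs)) (k xs))
natrec-prim {n} {z} {s} {k} (prim c₀ cc₀) (prim c₁ cc₁) (prim c₂ cc₂) =
  prim (comp (rec c₀ c₁) (c₂ ∷ tabulate proj)) λ xs →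
    trans (cong₂ (λ k ys → eval (rec c₀ c₁) (k ∷ ys)) (cc₂ xs) (evals-proj xs)) (go (k xs) xs)
  where
  go : ∀ k xs → eval (rec c₀ c₁) (k ∷ xs) ≡ natrec (z xs) (λ i r → s (i ∷ r ∷ xs)) k
  go zero    xs = cc₀ xs
  go (suc k) xs = trans (cc₁ _) (cong (λ r → s (k ∷ r ∷ xs)) (go k xs))

iter-prim : ∀ {n} {s : Vec ℕ (suc n) → ℕ} {x k : Vec ℕ n → ℕ} → Prim x →
            Prim s → Prim k → Prim (λ xs → iter (λ r → s (r ∷ xs)) (x xs) (k xs))
iter-prim px ps pk = natrec-prim px (wk ps) pk

if-prim : ∀ {n} {b : Vec ℕ n → Bool} {f g : Vec ℕ n → ℕ} → PrimB b → Prim f → Prim g →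
          Prim (λ xs → if b xs then f xs else g xs)
if-prim {b = b} {f} {g} (primB pb) pf pg =
  -- A recursion of length `χ b`: no step leaves the value of `g`, one step replaces it by that of
  -- `f`.
  ≗-prim (λ xs → eq (b xs)) (natrec-prim pg (wk (wk pf)) pb)
  where
  eq : ∀ b {x y} → natrec y (λ _ _ → x) (χ b) ≡ (if b then x else y)
  eq true  = refl
  eq false = refl

χ-if : ∀ b {c d} → (if b then χ c else χ d) ≡ χ (if b then c else d)
χ-if true  = refl
χ-if false = refl

ifB-prim : ∀ {n} {b c d : Vec ℕ n → Bool} → PrimB b → PrimB c → PrimB d →
           PrimB (λ xs → if b xs then c xs else d xs)
ifB-prim {b = b} pb (primB pc) (primB pd) = primB (≗-prim (λ xs → χ-if (b xs)) (if-prim pb pc pd))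

constB-prim : ∀ {n} b → PrimB {n} (λ _ → b)
constB-prim b = primB (const-prim (χ b))

≗-primB : ∀ {n} {b c : Vec ℕ n → Bool} → b ≗ c → PrimB b → PrimB c
≗-primB eq (primB p) = primB (≗-prim (λ xs → cong χ (eq xs)) p)

not-prim : ∀ {n} {b : Vec ℕ n → Bool} → PrimB b → PrimB (λ xs → not (b xs))
not-prim {b = b} p = ≗-primB (λ xs → eq (b xs)) (ifB-prim p (constB-prim false) (constB-prim true))
  where
  eq : ∀ b → (if b then false else true) ≡ not b
  eq true  = refl
  eq false = refl

infixr 6 _&&-prim_
infixr 5 _||-prim_

_&&-prim_ : ∀ {n} {b c : Vec ℕ n → Bool} → PrimB b → PrimB c → PrimB (λ xs → b xs && c xs)
_&&-prim_ {b = b} p q = ≗-primB (λ xs → eq (b xs)) (ifB-prim p q (constB-prim false))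
  where
  eq : ∀ b {c} → (if b then c else false) ≡ b && c
  eq true  = refl
  eq false = refl

_||-prim_ : ∀ {n} {b c : Vec ℕ n → Bool} → PrimB b → PrimB c → PrimB (λ xs → b xs || c xs)
_||-prim_ {b = b} p q = ≗-primB (λ xs → eq (b xs)) (ifB-prim p (constB-prim true) q)
  where
  eq : ∀ b {c} → (if b then true else c) ≡ b || c
  eq true  = refl
  eq false = refl

-- Arithmetic, comparisons and bounded quantifiers.

pred-prim : Prim₁ pred
pred-prim {g = g} p = ≗-prim (λ xs → eq (g xs)) (natrec-prim (const-prim 0) var₀ p)
  where
  eq : ∀ k → natrec 0 (λ i _ → i) k ≡ pred k
  eq zero    = refl
  eq (suc k) = refl

+-prim : Prim₂ _+_
+-prim {g = g} p q = ≗-prim (λ xs → eq (g xs)) (iter-prim q (suc-prim var₀) p)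
  where
  eq : ∀ k {y} → iter suc y k ≡ k + y
  eq zero    = refl
  eq (suc k) = cong suc (eq k)

∸-prim : Prim₂ _∸_
∸-prim {g = g} {h} p q = ≗-prim (λ xs → eq (h xs) (g xs)) (iter-prim p (pred-prim var₀) q)
  where
  eq : ∀ k x → iter pred x k ≡ x ∸ k
  eq zero    x = refl
  eq (suc k) x = trans (cong pred (eq k x)) (pred[m∸n]≡m∸[1+n] x k)

*-prim : Prim₂ _*_
*-prim {g = g} p q = ≗-prim (λ xs → eq (g xs)) (iter-prim (const-prim 0) (+-prim (wk q) var₀) p)
  where
  eq : ∀ k {y} → iter (y +_) 0 k ≡ k * y
  eq zero        = refl
  eq (suc k) {y} = cong (y +_) (eq k)

2^-prim : Prim₁ (2 ^_)
2^-prim {g = g} p = ≗-prim (λ xs → eq (g xs)) (iter-prim (const-prim 1) (*-prim (const-prim 2) var₀) p)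
  where
  eq : ∀ k → iter (2 *_) 1 k ≡ 2 ^ k
  eq zero    = refl
  eq (suc k) = cong (2 *_) (eq k)

≡ᵇ-prim : PrimB₂ _≡ᵇ_
≡ᵇ-prim {g = g} {h} p q = primB (≗-prim (λ xs → eq (g xs) (h xs))
  -- The two truncated differences vanish together exactly for equal arguments; a recursion of
  -- positive length returns 0.
  (natrec-prim (const-prim 1) (const-prim 0) (+-prim (∸-prim p q) (∸-prim q p))))
  where
  eq : ∀ x y → natrec 1 (λ _ _ → 0) ((x ∸ y) + (y ∸ x)) ≡ χ (x ≡ᵇ y)
  eq zero    zero    = refl
  eq zero    (suc y) = refl
  eq (suc x) zero    = refl
  eq (suc x) (suc y) = eq x y

<ᵇ-prim : PrimB₂ _<ᵇ_
<ᵇ-prim {g = g} {h} p q = primB (≗-prim (λ xs → eq (g xs) (h xs))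
  (natrec-prim (const-prim 0) (const-prim 1) (∸-prim q p)))
  where
  eq : ∀ x y → natrec 0 (λ _ _ → 1) (y ∸ x) ≡ χ (x <ᵇ y)
  eq zero    zero    = refl
  eq zero    (suc y) = refl
  eq (suc x) zero    = refl
  eq (suc x) (suc y) = eq x y

truth-prim : ∀ {n} {f : Vec ℕ n → ℕ} → Prim f → PrimB (λ xs → f xs ≡ᵇ 1)
truth-prim p = ≡ᵇ-prim p (const-prim 1)

χ≡ᵇ1 : ∀ b → (χ b ≡ᵇ 1) ≡ b
χ≡ᵇ1 true  = refl
χ≡ᵇ1 false = refl

-- The previous truth value reaches the step as a number and is read back by comparison with 1. As
-- `s` takes a Boolean, which cannot be a component of a vector of numbers, its primitive
-- recursiveness is assumed for every primitive recursive `c` in that place.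
natrecB-prim : ∀ {n} {z : Vec ℕ n → Bool} {s : Vec ℕ (suc n) → Bool → Bool} {k : Vec ℕ n → ℕ} →
               PrimB z →
               (∀ {c : Vec ℕ (2 + n) → Bool} → PrimB c → PrimB (λ ys → s (head ys ∷ tail (tail ys)) (c ys))) →
               Prim k → PrimB (λ xs → natrec (z xs) (λ i r → s (i ∷ xs) r) (k xs))
natrecB-prim {z = z} {s} {k} (primB pz) ps pk =
  primB (≗-prim (λ xs → eq (k xs) xs) (natrec-prim pz (indicator (ps (truth-prim var₁))) pk))
  where
  eq : ∀ k xs → natrec (χ (z xs)) (λ i r → χ (s (i ∷ xs) (r ≡ᵇ 1))) k
              ≡ χ (natrec (z xs) (λ i r → s (i ∷ xs) r) k)
  eq zero    xs = refl
  eq (suc k) xs = cong (λ r → χ (s (k ∷ xs) r)) (trans (cong (_≡ᵇ 1) (eq k xs)) (χ≡ᵇ1 _))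

-- In the step of a recursion the second component is the previous value; this makes a function of
-- the counter and the parameters ignore it.
skip₁ : ∀ {n} {f : Vec ℕ (suc n) → ℕ} → Prim f → Prim {2 + n} (λ ys → f (head ys ∷ tail (tail ys)))
skip₁ = reindex ρ λ { (i ∷ r ∷ xs) zero → refl ; (i ∷ r ∷ xs) (suc j) → refl }
  where
  ρ : ∀ {n} → Fin (suc n) → Fin (2 + n)
  ρ zero    = zero
  ρ (suc j) = suc (suc j)

skip₁B : ∀ {n} {b : Vec ℕ (suc n) → Bool} → PrimB b → PrimB {2 + n} (λ ys → b (head ys ∷ tail (tail ys)))
skip₁B (primB p) = primB (skip₁ p)

allBelow-prim : ∀ {n} {b : Vec ℕ (suc n) → Bool} {k : Vec ℕ n → ℕ} → PrimB b → Prim k →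
                PrimB (λ xs → allBelow (λ i → b (i ∷ xs)) (k xs))
allBelow-prim {b = b} pb pk =
  natrecB-prim {s = λ ys r → b ys && r} (constB-prim true) (skip₁B pb &&-prim_) pk

anyBelow-prim : ∀ {n} {b : Vec ℕ (suc n) → Bool} {k : Vec ℕ n → ℕ} → PrimB b → Prim k →
                PrimB (λ xs → anyBelow (λ i → b (i ∷ xs)) (k xs))
anyBelow-prim {b = b} pb pk =
  natrecB-prim {s = λ ys r → b ys || r} (constB-prim false) (skip₁B pb ||-prim_) pk

allBelow-∀ : ∀ {f k} → T (allBelow f k) → ∀ {i} → i < k → T (f i)
allBelow-∀ {k = suc k} h i<k with to T-∧ h | m≤n⇒m<n∨m≡n (s≤s⁻¹ i<k)
... | _ , hs | inj₁ i<k′  = allBelow-∀ hs i<k′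
... | hk , _ | inj₂ refl  = hk

∀-allBelow : ∀ {f} k → (∀ {i} → i < k → T (f i)) → T (allBelow f k)
∀-allBelow zero    h = _
∀-allBelow (suc k) h = from T-∧ (h ≤-refl , ∀-allBelow k (h ∘ m<n⇒m<1+n))

anyBelow-∃ : ∀ {f} k → T (anyBelow f k) → ∃[ i ] i < k × T (f i)
anyBelow-∃ (suc k) h with to T-∨ h
... | inj₁ hk = k , ≤-refl , hk
... | inj₂ hs with i , i<k , hi ← anyBelow-∃ k hs = i , m<n⇒m<1+n i<k , hi

∃-anyBelow : ∀ {f k i} → i < k → T (f i) → T (anyBelow f k)
∃-anyBelow {k = suc k} i<k hi with m≤n⇒m<n∨m≡n (s≤s⁻¹ i<k)
... | inj₁ i<k′ = from T-∨ (inj₂ (∃-anyBelow i<k′ hi))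
... | inj₂ refl = from T-∨ (inj₁ hi)

-- Pairs

-- The integer square root, from which the sum of the two components of a pair is recovered.
root : ℕ → ℕ
root = natrec 0 (λ i r → if suc i <ᵇ suc r * suc r then r else suc r)

root-prim : Prim₁ root
root-prim = natrec-prim (const-prim 0)
  (if-prim (<ᵇ-prim (suc-prim var₀) (*-prim (suc-prim var₁) (suc-prim var₁))) var₁ (suc-prim var₁))

root-spec : ∀ m → root m * root m ≤ m × m < suc (root m) * suc (root m)
root-spec zero = z≤n , s≤s z≤n
root-spec (suc m) with root m | root-spec m
... | r | lo , hi with suc m <ᵇ suc r * suc r in eq
...   | true  = m≤n⇒m≤1+n lo , <ᵇ⇒< _ _ (subst T (sym eq) _)
...   | false = ≮⇒≥ (λ lt → subst T eq (<⇒<ᵇ lt))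
              , ≤-<-trans hi (*-mono-< (n<1+n (suc r)) (n<1+n (suc r)))

square-cancel : ∀ {r s} → r * r < suc s * suc s → r ≤ s
square-cancel {r} {s} lt = ≮⇒≥ λ s<r → <⇒≱ lt (*-mono-≤ s<r s<r)

root-unique : ∀ {m s} → s * s ≤ m → m < suc s * suc s → root m ≡ s
root-unique {m} {s} lo hi = ≤-antisym
  (square-cancel (≤-<-trans (proj₁ (root-spec m)) hi))
  (square-cancel (≤-<-trans lo (proj₂ (root-spec m))))

root≤ : ∀ m → root m ≤ m
root≤ m with root m | proj₁ (root-spec m)
... | zero  | _  = z≤n
... | suc r | lo = ≤-trans (m≤m+n (suc r) (r * suc r)) lo

opaque
  unfolding ⟨_,_⟩

  π₁ π₂ : ℕ → ℕ
  π₁ n = pred n ∸ root (pred n) * root (pred n)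
  π₂ n = root (pred n) ∸ π₁ n

  ⟨⟩-prim : Prim₂ ⟨_,_⟩
  ⟨⟩-prim p q = suc-prim (+-prim (*-prim (+-prim p q) (+-prim p q)) p)

  π₁-prim : Prim₁ π₁
  π₁-prim p = ∸-prim (pred-prim p) (*-prim (root-prim (pred-prim p)) (root-prim (pred-prim p)))

  π₂-prim : Prim₁ π₂
  π₂-prim p = ∸-prim (root-prim (pred-prim p)) (π₁-prim p)

  -- Since `x` is at most `x + y`, adding it to the square of `x + y` stays below the next square.
  -- The components are then the distance from that square and what is left of the root.
  root-⟨⟩ : ∀ x y → root (pred ⟨ x , y ⟩) ≡ x + y
  root-⟨⟩ x y = root-unique (m≤m+n _ x) (begin-strict
    (x + y) * (x + y) + x                     ≤⟨ +-monoʳ-≤ ((x + y) * (x + y)) (m≤m+n x y) ⟩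
    (x + y) * (x + y) + (x + y)               ≡⟨ +-comm _ (x + y) ⟩
    suc (x + y) * (x + y)                     <⟨ *-monoʳ-< (suc (x + y)) (n<1+n (x + y)) ⟩
    suc (x + y) * suc (x + y)                 ∎)
    where open ≤-Reasoning

  π₁-⟨⟩ : ∀ x y → π₁ ⟨ x , y ⟩ ≡ x
  π₁-⟨⟩ x y rewrite root-⟨⟩ x y = m+n∸m≡n ((x + y) * (x + y)) x

  π₂-⟨⟩ : ∀ x y → π₂ ⟨ x , y ⟩ ≡ y
  π₂-⟨⟩ x y = trans (cong₂ _∸_ (root-⟨⟩ x y) (π₁-⟨⟩ x y)) (m+n∸m≡n x y)

  π₁≤ : ∀ n → π₁ n ≤ n
  π₁≤ n = ≤-trans (m∸n≤m (pred n) (root (pred n) * root (pred n))) pred[n]≤n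

  π₂≤pred : ∀ n → π₂ n ≤ pred n
  π₂≤pred n = ≤-trans (m∸n≤m (root (pred n)) (π₁ n)) (root≤ (pred n))

  ⟨⟩-positive : ∀ x y → 0 < ⟨ x , y ⟩
  ⟨⟩-positive x y = z<s

  ⟨⟩-mono-sum : ∀ {x y x′ y′} → x + y < x′ + y′ → ⟨ x , y ⟩ < ⟨ x′ , y′ ⟩
  ⟨⟩-mono-sum {x} {y} {x′} {y′} lt = s<s (begin-strict
    (x + y) * (x + y) + x        ≤⟨ +-monoʳ-≤ ((x + y) * (x + y)) (m≤m+n x y) ⟩
    (x + y) * (x + y) + (x + y)  ≡⟨ +-comm _ (x + y) ⟩
    suc (x + y) * (x + y)        <⟨ *-monoʳ-< (suc (x + y)) (n<1+n (x + y)) ⟩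
    suc (x + y) * suc (x + y)    ≤⟨ *-mono-≤ lt lt ⟩
    (x′ + y′) * (x′ + y′)        ≤⟨ m≤m+n _ x′ ⟩
    (x′ + y′) * (x′ + y′) + x′   ∎)
    where open ≤-Reasoning

π₂≤ : ∀ n → π₂ n ≤ n
π₂≤ n = ≤-trans (π₂≤pred n) pred[n]≤n

π₂< : ∀ {n} → 0 < n → π₂ n < n
π₂< {suc n} _ = s≤s (π₂≤pred (suc n))

⟨⟩≢0 : ∀ {x y} → ⟨ x , y ⟩ ≢ 0
⟨⟩≢0 eq = <⇒≢ (⟨⟩-positive _ _) (sym eq)

⟨⟩-injective : ∀ {x y x′ y′} → ⟨ x , y ⟩ ≡ ⟨ x′ , y′ ⟩ → x ≡ x′ × y ≡ y′
⟨⟩-injective {x} {y} {x′} {y′} eq =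
    trans (sym (π₁-⟨⟩ x y)) (trans (cong π₁ eq) (π₁-⟨⟩ x′ y′))
  , trans (sym (π₂-⟨⟩ x y)) (trans (cong π₂ eq) (π₂-⟨⟩ x′ y′))

y<⟨x,y⟩ : ∀ x y → y < ⟨ x , y ⟩
y<⟨x,y⟩ x y = subst (_< ⟨ x , y ⟩) (π₂-⟨⟩ x y) (π₂< (⟨⟩-positive x y))

-- Course-of-values recursion

-- Nested pairs ending in 0 with the latest value first, so the value at `i` lies `u ∸ suc i`
-- entries deep.
hist : (ℕ → ℕ → ℕ) → ℕ → ℕ
hist G = natrec 0 (λ u h → ⟨ G u h , h ⟩)

-- The value at i, read off the history h of the values below u.
recall : ℕ → ℕ → ℕ → ℕ
recall u h i = π₁ (iter π₂ h (u ∸ suc i))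

drop-⟨⟩ : ∀ x y k → iter π₂ ⟨ x , y ⟩ (suc k) ≡ iter π₂ y k
drop-⟨⟩ x y k = trans (sym (iter-comm π₂ ⟨ x , y ⟩ k)) (cong (λ l → iter π₂ l k) (π₂-⟨⟩ x y))

recall-hist : ∀ G {i u} → i < u → recall u (hist G u) i ≡ G i (hist G i)
recall-hist G {i} {suc u} i<1+u with m≤n⇒m<n∨m≡n (s≤s⁻¹ i<1+u)
... | inj₂ refl = trans (cong (π₁ ∘ iter π₂ (hist G (suc i))) (n∸n≡0 i)) (π₁-⟨⟩ _ _)
... | inj₁ i<u  = trans (cong (π₁ ∘ iter π₂ (hist G (suc u))) (+-∸-assoc 1 i<u))
                        (trans (cong π₁ (drop-⟨⟩ _ _ (u ∸ suc i))) (recall-hist G i<u))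

hist-prim : ∀ {n} {G : Vec ℕ (2 + n) → ℕ} {k : Vec ℕ n → ℕ} → Prim G → Prim k →
            Prim (λ xs → hist (λ u h → G (u ∷ h ∷ xs)) (k xs))
hist-prim pG pk = natrec-prim (const-prim 0) (⟨⟩-prim pG var₁) pk

recall-prim : Prim₃ recall
recall-prim pu ph pi = π₁-prim (iter-prim ph (π₂-prim var₀) (∸-prim pu (suc-prim pi)))

-- Recursion over term codes

-- A body receives the tag t and argument x of a code ⟨ t , x ⟩, the number d
-- of binders passed, and the values at x (for d and for suc d), π₁ x and π₂ x.
Body : Set
Body = ℕ → ℕ → ℕ → ℕ → ℕ → ℕ → ℕ → ℕ

opaque
  recStep : Body → (ℕ → ℕ → ℕ) → ℕ → ℕ → ℕ
  recStep b call n d = b (π₁ n) (π₂ n) d (call (π₂ n) d) (call (π₂ n) (suc d))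
                         (call (π₁ (π₂ n)) d) (call (π₂ (π₂ n)) d)

  -- The index ⟨ n , n + d ⟩ decreases at every call, also when d increases.
  courseStep : Body → ℕ → ℕ → ℕ
  courseStep b u h = recStep b (λ x d → recall u h ⟨ x , x + d ⟩) (π₁ u) (π₂ u ∸ π₁ u)

  termrec : Body → ℕ → ℕ → ℕ
  termrec b n d = courseStep b ⟨ n , n + d ⟩ (hist (courseStep b) ⟨ n , n + d ⟩)

  -- Pairs are compared by the sums of their components, here 2n + d. Going down to `x < n` lowers
  -- 2n by at least two, while a binder raises d by one. With d itself as second component the sum
  -- could stay the same.
  termrec-call : ∀ b {n x} d {e} → x < n → e ≤ suc d →
    recall ⟨ n , n + d ⟩ (hist (courseStep b) ⟨ n , n + d ⟩) ⟨ x , x + e ⟩ ≡ termrec b x e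
  termrec-call b {n} {x} d {e} x<n e≤ = recall-hist (courseStep b) (⟨⟩-mono-sum (begin-strict
    x + (x + e)      ≤⟨ +-monoʳ-≤ x (+-monoʳ-≤ x e≤) ⟩
    x + (x + suc d)  ≡⟨ cong (x +_) (+-suc x d) ⟩
    x + (suc x + d)  <⟨ +-mono-<-≤ x<n (+-monoˡ-≤ d x<n) ⟩
    n + (n + d)      ∎))
    where open ≤-Reasoning

  termrec-pos : ∀ b {n} d → 0 < n →
                termrec b n d ≡ b (π₁ n) (π₂ n) d (termrec b (π₂ n) d) (termrec b (π₂ n) (suc d))
                                  (termrec b (π₁ (π₂ n)) d) (termrec b (π₂ (π₂ n)) d)
  termrec-pos b {n} d 0<n
    rewrite π₁-⟨⟩ n (n + d) | π₂-⟨⟩ n (n + d) | m+n∸m≡n n d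
          | termrec-call b d (π₂< 0<n) (n≤1+n d)
          | termrec-call b d (π₂< 0<n) (≤-refl {suc d})
          | termrec-call b d (≤-<-trans (π₁≤ (π₂ n)) (π₂< 0<n)) (n≤1+n d)
          | termrec-call b d (≤-<-trans (π₂≤ (π₂ n)) (π₂< 0<n)) (n≤1+n d) = refl

  -- The number 0 is not a pair and its projections are not smaller, so nothing is claimed about the
  -- values handed to the body; knowing the tag will be enough.
  termrec-0 : ∀ b d → ∃[ A ] ∃[ A′ ] ∃[ B ] ∃[ C ] termrec b 0 d ≡ b (π₁ 0) (π₂ 0) d A A′ B C
  termrec-0 b d rewrite π₁-⟨⟩ 0 d | π₂-⟨⟩ 0 d = _ , _ , _ , _ , refl

  termrec-prim : ∀ {n} {b : Vec ℕ n → Body} {f g : Vec ℕ n → ℕ} →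
    (∀ {t x d A A′ B C : Vec ℕ (2 + n) → ℕ} →
     Prim t → Prim x → Prim d → Prim A → Prim A′ → Prim B → Prim C →
     Prim (λ ys → b (tail (tail ys)) (t ys) (x ys) (d ys) (A ys) (A′ ys) (B ys) (C ys))) →
    Prim f → Prim g → Prim (λ xs → termrec (b xs) (f xs) (g xs))
  termrec-prim {n} {b} {f} {g} pb pf pg = ≗-prim (λ xs → π₁-⟨⟩ _ _)
    -- The history one past the index has the value at the index as its head.
    (π₁-prim (hist-prim {G = G} G-prim (suc-prim (⟨⟩-prim pf (+-prim pf pg)))))
    where
    G : Vec ℕ (2 + n) → ℕ
    G ys = courseStep (b (tail (tail ys))) (head ys) (head (tail ys))
    node : ∀ {m} → Prim {suc m} (λ ys → π₁ (head ys))
    node = π₁-prim var₀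
    d-prim : ∀ {m} → Prim {suc m} (λ ys → π₂ (head ys) ∸ π₁ (head ys))
    d-prim = ∸-prim (π₂-prim var₀) node
    call-prim : ∀ {m} {x d : Vec ℕ (2 + m) → ℕ} → Prim x → Prim d →
                Prim (λ ys → recall (head ys) (head (tail ys)) ⟨ x ys , x ys + d ys ⟩)
    call-prim px pd = recall-prim var₀ var₁ (⟨⟩-prim px (+-prim px pd))
    G-prim : Prim G
    G-prim = pb (π₁-prim node) (π₂-prim node) d-prim
      (call-prim (π₂-prim node) d-prim) (call-prim (π₂-prim node) (suc-prim d-prim))
      (call-prim (π₁-prim (π₂-prim node)) d-prim) (call-prim (π₂-prim (π₂-prim node)) d-prim)

termrec-⟨⟩ : ∀ b t x d → termrec b ⟨ t , x ⟩ d ≡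
             b t x d (termrec b x d) (termrec b x (suc d)) (termrec b (π₁ x) d) (termrec b (π₂ x) d)
termrec-⟨⟩ b t x d with eq ← termrec-pos b d (⟨⟩-positive t x)
  rewrite π₁-⟨⟩ t x | π₂-⟨⟩ t x = eq

termrec-⟨⟨⟩⟩ : ∀ b t x y d → termrec b ⟨ t , ⟨ x , y ⟩ ⟩ d ≡
               b t ⟨ x , y ⟩ d (termrec b ⟨ x , y ⟩ d) (termrec b ⟨ x , y ⟩ (suc d)) (termrec b x d) (termrec b y d)
termrec-⟨⟨⟩⟩ b t x y d with eq ← termrec-⟨⟩ b t ⟨ x , y ⟩ d
  rewrite π₁-⟨⟩ x y | π₂-⟨⟩ x y = eq

-- Parity, halving and binary digits.

odd : ℕ → Bool
odd = natrec false (λ _ → not)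

half : ℕ → ℕ
half = natrec 0 (λ i r → if odd i then suc r else r)

odd-prim : ∀ {n} {f : Vec ℕ n → ℕ} → Prim f → PrimB (λ xs → odd (f xs))
odd-prim = natrecB-prim {s = λ _ → not} (constB-prim false) not-prim

half-prim : Prim₁ half
half-prim = natrec-prim (const-prim 0) (if-prim (odd-prim var₀) (suc-prim var₁) var₁)

odd-a+a : ∀ a n → odd (a + (a + n)) ≡ odd n
odd-a+a zero    n = refl
odd-a+a (suc a) n = trans (cong (not ∘ odd) (+-suc a (a + n)))
                          (trans (not-involutive _) (odd-a+a a n))

half-a+a : ∀ a n → half (a + (a + n)) ≡ a + half n
half-a+a zero    n = refl
half-a+a (suc a) n rewrite +-suc a (a + n) | odd-a+a a n | half-a+a a n with odd n
... | true  = refl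
... | false = refl

halves : ∀ n → n ≡ χ (odd n) + (half n + half n)
halves zero    = refl
halves (suc n) with odd n | halves n
... | true  | eq = cong suc (trans eq (sym (+-suc (half n) (half n))))
... | false | eq = cong suc eq

half< : ∀ n → half (suc n) ≤ n
half< n with odd n | halves n
... | true  | eq = subst (suc (half n) ≤_) (sym eq) (s≤s (m≤m+n _ _))
... | false | eq = subst (half n ≤_) (sym eq) (m≤m+n _ _)

opaque
  bit : ℕ → ℕ → Bool
  bit x n = odd (iter half n x)

  bit-prim : PrimB₂ bit
  bit-prim px pn = odd-prim (iter-prim pn (half-prim var₀) px)

  bit-suc : ∀ x n → bit (suc x) n ≡ bit x (half n)
  bit-suc x n = cong odd (sym (iter-comm half n x))

  -- By `halves`, a number is determined by its parity and its half, and the half has the remaining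
  -- digits. Halving is not structural, so the induction runs on a common bound `k`.
  bits-unique : ∀ {m n} → (∀ x → bit x m ≡ bit x n) → m ≡ n
  bits-unique {m} {n} = go (m + n) (m≤m+n m n) (m≤n+m n m)
    where
    go : ∀ k {m n} → m ≤ k → n ≤ k → (∀ x → bit x m ≡ bit x n) → m ≡ n
    go zero    z≤n z≤n _ = refl
    go (suc k) {m} {n} m≤ n≤ eq = begin
      m                               ≡⟨ halves m ⟩
      χ (odd m) + (half m + half m)   ≡⟨ cong₂ (λ b h → χ b + (h + h)) (eq 0) half≡ ⟩
      χ (odd n) + (half n + half n)   ≡⟨ halves n ⟨
      n                               ∎
      where
      open ≡-Reasoning
      bound : ∀ {m} → m ≤ suc k → half m ≤ k
      bound {zero}  _  = z≤n
      bound {suc m} m≤ = ≤-trans (half< m) (s≤s⁻¹ m≤)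
      half≡ : half m ≡ half n
      half≡ = go k (bound m≤) (bound n≤)
        (λ x → trans (sym (bit-suc x m)) (trans (eq (suc x)) (bit-suc x n)))

  bit-0 : ∀ x → bit x 0 ≡ false
  bit-0 zero    = refl
  bit-0 (suc x) = trans (bit-suc x 0) (bit-0 x)

  -- With digit `x` clear the addition makes no carry. For positive `x`, adding twice a power of two
  -- leaves the parity alone and adds that power to the half, which lowers `x` and `y` together.
  bit-2^+ : ∀ x y n → bit x n ≡ false → bit y (2 ^ x + n) ≡ (y ≡ᵇ x) || bit y n
  bit-2^+ zero    zero    n eq = cong not eq
  bit-2^+ zero    (suc y) n eq = trans (bit-suc y (suc n))
    (trans (cong (λ b → bit y (if b then suc (half n) else half n)) eq) (sym (bit-suc y n)))
  bit-2^+ (suc x) zero    n eq = trans (cong odd (+-assoc (2 ^ x) _ n))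
    (trans (cong (λ k → odd (2 ^ x + (k + n))) (+-identityʳ (2 ^ x))) (odd-a+a (2 ^ x) n))
  bit-2^+ (suc x) (suc y) n eq = begin
    bit (suc y) (2 ^ suc x + n)      ≡⟨ bit-suc y _ ⟩
    bit y (half (2 ^ suc x + n))     ≡⟨ cong (bit y ∘ half) (trans (+-assoc (2 ^ x) _ n)
                                          (cong (λ k → 2 ^ x + (k + n)) (+-identityʳ (2 ^ x)))) ⟩
    bit y (half (2 ^ x + (2 ^ x + n))) ≡⟨ cong (bit y) (half-a+a (2 ^ x) n) ⟩
    bit y (2 ^ x + half n)           ≡⟨ bit-2^+ x y (half n) (trans (sym (bit-suc x n)) eq) ⟩
    (y ≡ᵇ x) || bit y (half n)       ≡⟨ cong ((y ≡ᵇ x) ||_) (bit-suc y n) ⟨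
    (y ≡ᵇ x) || bit (suc y) n        ∎
    where open ≡-Reasoning

  -- Members of a set are smaller than its code, so the code itself bounds every search through the
  -- set.
  bit⇒< : ∀ {x n} → T (bit x n) → x < n
  bit⇒< {zero}  {suc n} _ = z<s
  bit⇒< {suc x} {n} h = ≤-<-trans (bit⇒< {x} (subst T (bit-suc x n) h)) (half<′ n (subst T (bit-suc x n) h))
    where
    half<′ : ∀ n → T (bit x (half n)) → half n < n
    half<′ zero    h = contradiction (subst T (bit-0 x) h) id
    half<′ (suc n) _ = s≤s (half< n)

-- Codes of finite sets

insert : ℕ → ℕ → ℕ
insert x G = if bit x G then G else 2 ^ x + G

insert-prim : Prim₂ insert
insert-prim px pG = if-prim (bit-prim px pG) pG (+-prim (2^-prim px) pG)

T⇒≡true : ∀ {b} → T b → b ≡ true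
T⇒≡true = to T-≡

¬T⇒≡false : ∀ {b} → ¬ T b → b ≡ false
¬T⇒≡false {true}  h = contradiction _ h
¬T⇒≡false {false} _ = refl

bit-codeSet : ∀ {x} xs → T (bit x (codeSet xs)) ⇔ x ∈ xs
bit-codeSet xs = mk⇔ (sound xs) (complete xs)
  where
  new : ∀ {x} xs y → ¬ x ∈ xs → bit y (2 ^ x + codeSet xs) ≡ (y ≡ᵇ x) || bit y (codeSet xs)
  sound : ∀ {x} xs → T (bit x (codeSet xs)) → x ∈ xs
  sound {x} [] h = contradiction (subst T (bit-0 x) h) id
  sound {x} (y ∷ ys) h with (_∈?_ _≟_ y ys)
  ... | yes _ = there (sound ys h)
  ... | no y∉ with to T-∨ (subst T (new ys x y∉) h)
  ...   | inj₁ eq = here (≡ᵇ⇒≡ x y eq)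
  ...   | inj₂ h′ = there (sound ys h′)
  -- No carry occurs: by `sound` for the tail, digit `x` is still clear.
  new {x} xs y x∉ = bit-2^+ x y (codeSet xs) (¬T⇒≡false (x∉ ∘ sound xs))
  complete : ∀ {x} xs → x ∈ xs → T (bit x (codeSet xs))
  complete {x} (y ∷ ys) x∈ with (_∈?_ _≟_ y ys) | x∈
  ... | yes y∈ | here refl = complete ys y∈
  ... | yes _  | there x∈′ = complete ys x∈′
  ... | no y∉  | here refl = subst T (sym (new ys x y∉)) (from T-∨ (inj₁ (≡⇒≡ᵇ x x refl)))
  ... | no y∉  | there x∈′ = subst T (sym (new ys x y∉)) (from (T-∨ {x ≡ᵇ y}) (inj₂ (complete ys x∈′)))

T-ext : ∀ {b c} → (T b → T c) → (T c → T b) → b ≡ c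
T-ext {true}  {true}  _ _ = refl
T-ext {true}  {false} f _ = contradiction (f _) id
T-ext {false} {true}  _ g = contradiction (g _) id
T-ext {false} {false} _ _ = refl

codeSet-cong : ∀ {xs ys} → xs ∼[ set ] ys → codeSet xs ≡ codeSet ys
codeSet-cong {xs} {ys} eq = bits-unique λ x → T-ext
  (from (bit-codeSet ys) ∘ to eq ∘ to (bit-codeSet xs))
  (from (bit-codeSet xs) ∘ from eq ∘ to (bit-codeSet ys))

codeSet-injective : ∀ {xs ys} → codeSet xs ≡ codeSet ys → xs ∼[ set ] ys
codeSet-injective {xs} {ys} eq {x} = mk⇔
  (to (bit-codeSet ys) ∘ subst (T ∘ bit x) eq ∘ from (bit-codeSet xs))
  (to (bit-codeSet xs) ∘ subst (T ∘ bit x) (sym eq) ∘ from (bit-codeSet ys))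

insert-codeSet : ∀ x xs → insert x (codeSet xs) ≡ codeSet (x ∷ xs)
insert-codeSet x xs with (_∈?_ _≟_ x xs)
... | yes x∈ rewrite T⇒≡true (from (bit-codeSet xs) x∈)              = refl
... | no x∉  rewrite ¬T⇒≡false (x∉ ∘ to (bit-codeSet xs)) = refl

elemsBelow : ℕ → ℕ → List ℕ
elemsBelow G = natrec [] (λ x xs → if bit x G then x ∷ xs else xs)

∈-elemsBelow : ∀ G k {x} → x ∈ elemsBelow G k ⇔ (x < k × T (bit x G))
∈-elemsBelow G k = mk⇔ (sound k) (λ (x<k , h) → complete k x<k h)
  where
  sound : ∀ k {x} → x ∈ elemsBelow G k → x < k × T (bit x G)
  sound (suc k) x∈ with bit k G in eq
  ... | false with lt , h ← sound k x∈ = m<n⇒m<1+n lt , h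
  ... | true with x∈
  ...   | here refl = ≤-refl , subst T (sym eq) _
  ...   | there x∈′ with lt , h ← sound k x∈′ = m<n⇒m<1+n lt , h
  complete : ∀ k {x} → x < k → T (bit x G) → x ∈ elemsBelow G k
  complete (suc k) x<k h with bit k G in eq | m≤n⇒m<n∨m≡n (s≤s⁻¹ x<k)
  ... | true  | inj₁ x<k′ = there (complete k x<k′ h)
  ... | true  | inj₂ refl = here refl
  ... | false | inj₁ x<k′ = complete k x<k′ h
  ... | false | inj₂ refl = contradiction (subst T eq h) id

elems : ℕ → List ℕ
elems G = elemsBelow G G

∈-elems : ∀ G {x} → x ∈ elems G ⇔ T (bit x G)
∈-elems G = mk⇔ (proj₂ ∘ to (∈-elemsBelow G G))
                (λ h → from (∈-elemsBelow G G) (bit⇒< h , h))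

codeSet-elems : ∀ G → codeSet (elems G) ≡ G
codeSet-elems G = bits-unique λ x → T-ext
  (to (∈-elems G) ∘ to (bit-codeSet (elems G))) (from (bit-codeSet (elems G)) ∘ from (∈-elems G))

mapSet : (ℕ → ℕ) → ℕ → ℕ
mapSet f G = natrec 0 (λ x r → if bit x G then insert (f x) r else r) G

mapSet-prim : ∀ {n} {f : Vec ℕ (suc n) → ℕ} {G : Vec ℕ n → ℕ} → Prim f → Prim G →
              Prim (λ xs → mapSet (λ x → f (x ∷ xs)) (G xs))
mapSet-prim {n} {f} {G} pf pG =
  natrec-prim {s = λ ys → if bit (head ys) (G (tail (tail ys)))
                          then insert (f (head ys ∷ tail (tail ys))) (head (tail ys)) else head (tail ys)}
    (const-prim 0) (if-prim (bit-prim var₀ (wk (wk pG))) (insert-prim pf′ var₁) var₁) pG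
  where
  pf′ : Prim (λ ys → f (head ys ∷ tail (tail ys)))
  pf′ = skip₁ pf

-- The recursion visits the members by size and without repetition. This is another list of the same
-- set, and `codeSet-cong` absorbs the difference.
mapSet-codeSet : ∀ f xs → mapSet f (codeSet xs) ≡ codeSet (map f xs)
mapSet-codeSet f xs = trans (go (codeSet xs) (codeSet xs)) (codeSet-cong (∼-map-cong (λ _ → refl)
  (mk⇔ (to (bit-codeSet xs) ∘ to (∈-elems (codeSet xs)))
       (from (∈-elems (codeSet xs)) ∘ from (bit-codeSet xs)))))
  where
  go : ∀ G k → natrec 0 (λ x r → if bit x G then insert (f x) r else r) k
             ≡ codeSet (map f (elemsBelow G k))
  go G zero = refl
  go G (suc k) with bit k G
  ... | false = go G k
  ... | true  = trans (cong (insert (f k)) (go G k)) (insert-codeSet (f k) (map f (elemsBelow G k)))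

all∈ : (ℕ → Bool) → ℕ → Bool
all∈ f G = allBelow (λ x → if bit x G then f x else true) G

all∈-prim : ∀ {n} {f : Vec ℕ (suc n) → Bool} {G : Vec ℕ n → ℕ} → PrimB f → Prim G →
            PrimB (λ xs → all∈ (λ x → f (x ∷ xs)) (G xs))
all∈-prim {f = f} {G} pf pG =
  allBelow-prim {b = λ ys → if bit (head ys) (G (tail ys)) then f ys else true}
    (ifB-prim (bit-prim var₀ (wk pG)) pf (constB-prim true)) pG

all∈-codeSet : ∀ f xs → T (all∈ f (codeSet xs)) ⇔ All (T ∘ f) xs
all∈-codeSet f xs = mk⇔
  (λ h → All.tabulate λ {x} x∈ → let b = from (bit-codeSet xs) x∈ in
     subst (λ c → T (if c then f x else true)) (T⇒≡true b)
           (allBelow-∀ {f = λ x → if bit x (codeSet xs) then f x else true} h (bit⇒< b)))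
  (λ h → ∀-allBelow (codeSet xs) λ {x} _ → guarded x h)
  where
  guarded : ∀ x → All (T ∘ f) xs → T (if bit x (codeSet xs) then f x else true)
  guarded x h with bit x (codeSet xs) in eq
  ... | true  = All.lookup h (to (bit-codeSet xs) (subst T (sym eq) _))
  ... | false = _

-- Codes of terms

tag arg : Term → ℕ
tag (v i)   = 0
tag bot     = 1
tag 𝟎       = 2
tag (𝐒 t)   = 3
tag (t ≐ u) = 4
tag (∼ t)   = 5
tag (t ∨ u) = 6
tag (ƛ t)   = 7
tag (t · u) = 8
tag 𝓡       = 9
tag 𝓐       = 10

arg (v i)   = i
arg bot     = 0
arg 𝟎       = 0
arg (𝐒 t)   = ⌜ t ⌝
arg (t ≐ u) = ⟨ ⌜ t ⌝ , ⌜ u ⌝ ⟩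
arg (∼ t)   = ⌜ t ⌝
arg (t ∨ u) = ⟨ ⌜ t ⌝ , ⌜ u ⌝ ⟩
arg (ƛ t)   = ⌜ t ⌝
arg (t · u) = ⟨ ⌜ t ⌝ , ⌜ u ⌝ ⟩
arg 𝓡       = 0
arg 𝓐       = 0

⌜⌝-tag-arg : ∀ t → ⌜ t ⌝ ≡ ⟨ tag t , arg t ⟩
⌜⌝-tag-arg (v i)   = refl
⌜⌝-tag-arg bot     = refl
⌜⌝-tag-arg 𝟎       = refl
⌜⌝-tag-arg (𝐒 t)   = refl
⌜⌝-tag-arg (t ≐ u) = refl
⌜⌝-tag-arg (∼ t)   = refl
⌜⌝-tag-arg (t ∨ u) = refl
⌜⌝-tag-arg (ƛ t)   = refl
⌜⌝-tag-arg (t · u) = refl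
⌜⌝-tag-arg 𝓡       = refl
⌜⌝-tag-arg 𝓐       = refl

⌜⌝≢0 : ∀ t → ⌜ t ⌝ ≢ 0
⌜⌝≢0 t eq = ⟨⟩≢0 (trans (sym (⌜⌝-tag-arg t)) eq)

node : ℕ → ℕ → Term → Term → Term → Term
node 0 x t u₁ u₂ = v x
node 1 x t u₁ u₂ = bot
node 2 x t u₁ u₂ = 𝟎
node 3 x t u₁ u₂ = 𝐒 t
node 4 x t u₁ u₂ = u₁ ≐ u₂
node 5 x t u₁ u₂ = ∼ t
node 6 x t u₁ u₂ = u₁ ∨ u₂
node 7 x t u₁ u₂ = ƛ t
node 8 x t u₁ u₂ = u₁ · u₂
node 9 x t u₁ u₂ = 𝓡
node _ x t u₁ u₂ = 𝓐

-- The first argument is fuel.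
decode : ℕ → ℕ → Term
decode zero    n = 𝟎
decode (suc k) n = node (π₁ n) (π₂ n) (decode k (π₂ n)) (decode k (π₁ (π₂ n))) (decode k (π₂ (π₂ n)))

x≤⟨x,y⟩ : ∀ x y → x ≤ ⟨ x , y ⟩
x≤⟨x,y⟩ x y = subst (_≤ ⟨ x , y ⟩) (π₁-⟨⟩ x y) (π₁≤ ⟨ x , y ⟩)

decode-⌜⌝ : ∀ k t → ⌜ t ⌝ ≤ k → decode k ⌜ t ⌝ ≡ t
decode-⌜⌝ zero    t       le = contradiction (n≤0⇒n≡0 le) (⌜⌝≢0 t)
decode-⌜⌝ (suc k) (v i)   le rewrite π₁-⟨⟩ 0 i | π₂-⟨⟩ 0 i  = refl
decode-⌜⌝ (suc k) bot     le rewrite π₁-⟨⟩ 1 0  = refl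
decode-⌜⌝ (suc k) 𝟎       le rewrite π₁-⟨⟩ 2 0  = refl
decode-⌜⌝ (suc k) 𝓡       le rewrite π₁-⟨⟩ 9 0  = refl
decode-⌜⌝ (suc k) 𝓐       le rewrite π₁-⟨⟩ 10 0 = refl
decode-⌜⌝ (suc k) (𝐒 t)   le rewrite π₁-⟨⟩ 3 ⌜ t ⌝ | π₂-⟨⟩ 3 ⌜ t ⌝ =
  cong 𝐒_ (decode-⌜⌝ k t (s≤s⁻¹ (≤-trans (y<⟨x,y⟩ 3 ⌜ t ⌝) le)))
decode-⌜⌝ (suc k) (∼ t)   le rewrite π₁-⟨⟩ 5 ⌜ t ⌝ | π₂-⟨⟩ 5 ⌜ t ⌝ =
  cong ∼_ (decode-⌜⌝ k t (s≤s⁻¹ (≤-trans (y<⟨x,y⟩ 5 ⌜ t ⌝) le)))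
decode-⌜⌝ (suc k) (ƛ t)   le rewrite π₁-⟨⟩ 7 ⌜ t ⌝ | π₂-⟨⟩ 7 ⌜ t ⌝ =
  cong ƛ_ (decode-⌜⌝ k t (s≤s⁻¹ (≤-trans (y<⟨x,y⟩ 7 ⌜ t ⌝) le)))
decode-⌜⌝ (suc k) (t ≐ u) le
  rewrite π₁-⟨⟩ 4 ⟨ ⌜ t ⌝ , ⌜ u ⌝ ⟩ | π₂-⟨⟩ 4 ⟨ ⌜ t ⌝ , ⌜ u ⌝ ⟩
        | π₁-⟨⟩ ⌜ t ⌝ ⌜ u ⌝ | π₂-⟨⟩ ⌜ t ⌝ ⌜ u ⌝ =
  cong₂ _≐_ (decode-⌜⌝ k t (≤-trans (x≤⟨x,y⟩ _ _) (s≤s⁻¹ (≤-trans (y<⟨x,y⟩ 4 _) le))))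
            (decode-⌜⌝ k u (≤-trans (<⇒≤ (y<⟨x,y⟩ _ _)) (s≤s⁻¹ (≤-trans (y<⟨x,y⟩ 4 _) le))))
decode-⌜⌝ (suc k) (t ∨ u) le
  rewrite π₁-⟨⟩ 6 ⟨ ⌜ t ⌝ , ⌜ u ⌝ ⟩ | π₂-⟨⟩ 6 ⟨ ⌜ t ⌝ , ⌜ u ⌝ ⟩
        | π₁-⟨⟩ ⌜ t ⌝ ⌜ u ⌝ | π₂-⟨⟩ ⌜ t ⌝ ⌜ u ⌝ =
  cong₂ _∨_ (decode-⌜⌝ k t (≤-trans (x≤⟨x,y⟩ _ _) (s≤s⁻¹ (≤-trans (y<⟨x,y⟩ 6 _) le))))
            (decode-⌜⌝ k u (≤-trans (<⇒≤ (y<⟨x,y⟩ _ _)) (s≤s⁻¹ (≤-trans (y<⟨x,y⟩ 6 _) le))))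
decode-⌜⌝ (suc k) (t · u) le
  rewrite π₁-⟨⟩ 8 ⟨ ⌜ t ⌝ , ⌜ u ⌝ ⟩ | π₂-⟨⟩ 8 ⟨ ⌜ t ⌝ , ⌜ u ⌝ ⟩
        | π₁-⟨⟩ ⌜ t ⌝ ⌜ u ⌝ | π₂-⟨⟩ ⌜ t ⌝ ⌜ u ⌝ =
  cong₂ _·_ (decode-⌜⌝ k t (≤-trans (x≤⟨x,y⟩ _ _) (s≤s⁻¹ (≤-trans (y<⟨x,y⟩ 8 _) le))))
            (decode-⌜⌝ k u (≤-trans (<⇒≤ (y<⟨x,y⟩ _ _)) (s≤s⁻¹ (≤-trans (y<⟨x,y⟩ 8 _) le))))

-- Decoding is a left inverse, the code itself being enough fuel; this avoids comparing two terms
-- constructor by constructor.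
⌜⌝-injective : ∀ {t u} → ⌜ t ⌝ ≡ ⌜ u ⌝ → t ≡ u
⌜⌝-injective {t} {u} eq = begin
  t                       ≡⟨ decode-⌜⌝ ⌜ t ⌝ t ≤-refl ⟨
  decode ⌜ t ⌝ ⌜ t ⌝      ≡⟨ cong (λ n → decode n n) eq ⟩
  decode ⌜ u ⌝ ⌜ u ⌝      ≡⟨ decode-⌜⌝ ⌜ u ⌝ u ≤-refl ⟩
  u                       ∎
  where open ≡-Reasoning

⌜⌝-tag : ∀ t {k x} → ⌜ t ⌝ ≡ ⟨ k , x ⟩ → tag t ≡ k
⌜⌝-tag t eq = proj₁ (⟨⟩-injective (trans (sym (⌜⌝-tag-arg t)) eq))

𝐒-view : ∀ t {x} → ⌜ t ⌝ ≡ ⟨ 3 , x ⟩ → ∃[ u ] t ≡ 𝐒 u × ⌜ u ⌝ ≡ x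
𝐒-view t eq with t | ⌜⌝-tag t eq | eq
... | 𝐒 u | refl | eq = u , refl , proj₂ (⟨⟩-injective eq)

ƛ-view : ∀ t {x} → ⌜ t ⌝ ≡ ⟨ 7 , x ⟩ → ∃[ u ] t ≡ (ƛ u) × ⌜ u ⌝ ≡ x
ƛ-view t eq with t | ⌜⌝-tag t eq | eq
... | ƛ u | refl | eq = u , refl , proj₂ (⟨⟩-injective eq)

·-view : ∀ t {x y} → ⌜ t ⌝ ≡ ⟨ 8 , ⟨ x , y ⟩ ⟩ →
         ∃₂ λ u₁ u₂ → t ≡ u₁ · u₂ × ⌜ u₁ ⌝ ≡ x × ⌜ u₂ ⌝ ≡ y
·-view t eq with t | ⌜⌝-tag t eq | eq
... | u₁ · u₂ | refl | eq = u₁ , u₂ , refl , ⟨⟩-injective (proj₂ (⟨⟩-injective eq))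

-- Recursion by the shape of a term

byShape : ℕ → (var abs unary binary leaf : ℕ) → ℕ
byShape t var abs unary binary leaf =
  if t ≡ᵇ 0 then var else
  if t ≡ᵇ 7 then abs else
  if (t ≡ᵇ 3) || (t ≡ᵇ 5) then unary else
  if (t ≡ᵇ 4) || (t ≡ᵇ 6) || (t ≡ᵇ 8) then binary else leaf

is-prim : ∀ k {n} {f : Vec ℕ n → ℕ} → Prim f → PrimB (λ xs → f xs ≡ᵇ k)
is-prim k p = ≡ᵇ-prim p (const-prim k)

byShape-prim : ∀ {n} {t a b c d e : Vec ℕ n → ℕ} →
               Prim t → Prim a → Prim b → Prim c → Prim d → Prim e →
               Prim (λ xs → byShape (t xs) (a xs) (b xs) (c xs) (d xs) (e xs))
byShape-prim pt pa pb pc pd pe =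
  if-prim (is-prim 0 pt) pa
  (if-prim (is-prim 7 pt) pb
  (if-prim (is-prim 3 pt ||-prim is-prim 5 pt) pc
  (if-prim (is-prim 4 pt ||-prim is-prim 6 pt ||-prim is-prim 8 pt) pd pe)))

-- Variables i below d binders are mapped to w i d. Unused tags are mapped
-- to the code of 𝓐, so that all values are codes of terms.
mapBody : (ℕ → ℕ → ℕ) → Body
mapBody w t x d A A′ B C =
  byShape t (w x d) ⟨ 7 , A′ ⟩ ⟨ t , A ⟩ ⟨ t , ⟨ B , C ⟩ ⟩ ⟨ (if t <ᵇ 10 then t else 10) , 0 ⟩

mapVars : (ℕ → ℕ → ℕ) → ℕ → ℕ → ℕ
mapVars w = termrec (mapBody w)

mapVars-prim : ∀ {n} {w : Vec ℕ n → ℕ → ℕ → ℕ} {f g : Vec ℕ n → ℕ} →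
  (∀ {i d : Vec ℕ (2 + n) → ℕ} → Prim i → Prim d → Prim (λ ys → w (tail (tail ys)) (i ys) (d ys))) →
  Prim f → Prim g → Prim (λ xs → mapVars (w xs) (f xs) (g xs))
mapVars-prim {w = w} pw = termrec-prim {b = λ xs → mapBody (w xs)} λ pt px pd pA pA′ pB pC →
  byShape-prim pt (pw px pd) (⟨⟩-prim (const-prim 7) pA′) (⟨⟩-prim pt pA) (⟨⟩-prim pt (⟨⟩-prim pB pC))
    (⟨⟩-prim (if-prim (<ᵇ-prim pt (const-prim 10)) pt (const-prim 10)) (const-prim 0))

-- One layer of an operation that changes only variables and counts binders. Shifting, substitution
-- and instantiation all have this form, so on codes each has to be compared at variables only.
push : (ℕ → Term → Term) → ℕ → Term → Term
push τ d (v i)   = τ d (v i)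
push τ d bot     = bot
push τ d 𝟎       = 𝟎
push τ d (𝐒 t)   = 𝐒 τ d t
push τ d (t ≐ u) = τ d t ≐ τ d u
push τ d (∼ t)   = ∼ τ d t
push τ d (t ∨ u) = τ d t ∨ τ d u
push τ d (ƛ t)   = ƛ τ (suc d) t
push τ d (t · u) = τ d t · τ d u
push τ d 𝓡       = 𝓡
push τ d 𝓐       = 𝓐

module _ {w : ℕ → ℕ → ℕ} {τ : ℕ → Term → Term}
         (pushes : ∀ d t → τ d t ≡ push τ d t) (vars : ∀ d i → w i d ≡ ⌜ τ d (v i) ⌝) where

  mapVars-⌜⌝ : ∀ t d → mapVars w ⌜ t ⌝ d ≡ ⌜ τ d t ⌝
  mapVars-push : ∀ t d → mapVars w ⌜ t ⌝ d ≡ ⌜ push τ d t ⌝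

  mapVars-⌜⌝ t d = trans (mapVars-push t d) (cong ⌜_⌝ (sym (pushes d t)))

  mapVars-push (v i)   d = trans (termrec-⟨⟩ _ 0 i d) (vars d i)
  mapVars-push bot     d = termrec-⟨⟩ _ 1 0 d
  mapVars-push 𝟎       d = termrec-⟨⟩ _ 2 0 d
  mapVars-push (𝐒 t)   d = trans (termrec-⟨⟩ _ 3 _ d) (cong (⟨ 3 ,_⟩) (mapVars-⌜⌝ t d))
  mapVars-push (t ≐ u) d = trans (termrec-⟨⟨⟩⟩ _ 4 _ _ d)
    (cong₂ (λ x y → ⟨ 4 , ⟨ x , y ⟩ ⟩) (mapVars-⌜⌝ t d) (mapVars-⌜⌝ u d))
  mapVars-push (∼ t)   d = trans (termrec-⟨⟩ _ 5 _ d) (cong (⟨ 5 ,_⟩) (mapVars-⌜⌝ t d))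
  mapVars-push (t ∨ u) d = trans (termrec-⟨⟨⟩⟩ _ 6 _ _ d)
    (cong₂ (λ x y → ⟨ 6 , ⟨ x , y ⟩ ⟩) (mapVars-⌜⌝ t d) (mapVars-⌜⌝ u d))
  mapVars-push (ƛ t)   d = trans (termrec-⟨⟩ _ 7 _ d) (cong (⟨ 7 ,_⟩) (mapVars-⌜⌝ t (suc d)))
  mapVars-push (t · u) d = trans (termrec-⟨⟨⟩⟩ _ 8 _ _ d)
    (cong₂ (λ x y → ⟨ 8 , ⟨ x , y ⟩ ⟩) (mapVars-⌜⌝ t d) (mapVars-⌜⌝ u d))
  mapVars-push 𝓡       d = termrec-⟨⟩ _ 9 0 d
  mapVars-push 𝓐       d = termrec-⟨⟩ _ 10 0 d

-- The traversal that keeps all variables fixes the codes of terms and sends every number to the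
-- code of a term. Hence its fixed points are exactly the codes.
isTerm : ℕ → Bool
isTerm n = mapVars (λ i d → ⟨ 0 , i ⟩) n 0 ≡ᵇ n

isTerm-prim : ∀ {n} {f : Vec ℕ n → ℕ} → Prim f → PrimB (λ xs → isTerm (f xs))
isTerm-prim pf = ≡ᵇ-prim
  (mapVars-prim {w = λ _ i d → ⟨ 0 , i ⟩} (λ pi pd → ⟨⟩-prim (const-prim 0) pi) pf (const-prim 0)) pf

isTerm-⌜⌝ : ∀ t → T (isTerm ⌜ t ⌝)
isTerm-⌜⌝ t = ≡⇒≡ᵇ _ _ (mapVars-⌜⌝ {τ = λ d t → t} pushes (λ d i → refl) t 0)
  where
  pushes : ∀ d t → t ≡ push (λ d t → t) d t
  pushes d (v i)   = refl
  pushes d bot     = refl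
  pushes d 𝟎       = refl
  pushes d (𝐒 t)   = refl
  pushes d (t ≐ u) = refl
  pushes d (∼ t)   = refl
  pushes d (t ∨ u) = refl
  pushes d (ƛ t)   = refl
  pushes d (t · u) = refl
  pushes d 𝓡       = refl
  pushes d 𝓐       = refl

IsCode : ℕ → Set
IsCode n = ∃[ t ] ⌜ t ⌝ ≡ n

mapBody-isCode : ∀ t {x d A A′ B C} → IsCode A → IsCode A′ → IsCode B → IsCode C →
                 IsCode (mapBody (λ i d → ⟨ 0 , i ⟩) t x d A A′ B C)
mapBody-isCode 0  a a′ b c = v _ , refl
mapBody-isCode 1  a a′ b c = bot , refl
mapBody-isCode 2  a a′ b c = 𝟎 , refl
mapBody-isCode 3  (t , refl) a′ b c = 𝐒 t , refl
mapBody-isCode 4  a a′ (t , refl) (u , refl) = t ≐ u , refl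
mapBody-isCode 5  (t , refl) a′ b c = ∼ t , refl
mapBody-isCode 6  a a′ (t , refl) (u , refl) = t ∨ u , refl
mapBody-isCode 7  a (t , refl) b c = (ƛ t) , refl
mapBody-isCode 8  a a′ (t , refl) (u , refl) = t · u , refl
mapBody-isCode 9  a a′ b c = 𝓡 , refl
mapBody-isCode (suc (suc (suc (suc (suc (suc (suc (suc (suc (suc t)))))))))) a a′ b c = 𝓐 , refl

isTerm-sound : ∀ n → T (isTerm n) → IsCode n
-- All `d` are treated at once, because the call below an abstraction is at `suc d`.
isTerm-sound n h = subst IsCode (≡ᵇ⇒≡ _ n h) (<-rec (λ n → ∀ d → IsCode (mapVars _ n d)) decoded n 0)
  where
  decoded : ∀ n → (∀ {m} → m < n → ∀ d → IsCode (mapVars (λ i d → ⟨ 0 , i ⟩) m d)) →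
         ∀ d → IsCode (mapVars (λ i d → ⟨ 0 , i ⟩) n d)
  decoded zero ih d with termrec-0 (mapBody (λ i d → ⟨ 0 , i ⟩)) d
  ... | A , A′ , B , C , eq rewrite eq | n≤0⇒n≡0 (π₁≤ 0) = v (π₂ 0) , refl
  decoded n@(suc _) ih d rewrite termrec-pos (mapBody (λ i d → ⟨ 0 , i ⟩)) {n} d z<s =
    mapBody-isCode (π₁ n) {π₂ n} {d} (ih (π₂< z<s) d) (ih (π₂< z<s) (suc d))
      (ih (≤-<-trans (π₁≤ (π₂ n)) (π₂< z<s)) d) (ih (≤-<-trans (π₂≤ (π₂ n)) (π₂< z<s)) d)

<ᵇ-true : ∀ {i k} → i < k → (i <ᵇ k) ≡ true
<ᵇ-true i<k = T⇒≡true (<⇒<ᵇ i<k)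

<ᵇ-false : ∀ {i k} → ¬ i < k → (i <ᵇ k) ≡ false
<ᵇ-false {i} {k} i≮k = ¬T⇒≡false (i≮k ∘ <ᵇ⇒< i k)

≡ᵇ-true : ∀ {m n} → m ≡ n → (m ≡ᵇ n) ≡ true
≡ᵇ-true {m} {n} eq = T⇒≡true (≡⇒≡ᵇ m n eq)

≡ᵇ-false : ∀ {m n} → m ≢ n → (m ≡ᵇ n) ≡ false
≡ᵇ-false {m} {n} neq = ¬T⇒≡false (neq ∘ ≡ᵇ⇒≡ m n)

-- Shifting, substitution and instantiation on codes.

shiftC : ℕ → ℕ
shiftC n = mapVars (λ i d → if i <ᵇ d then ⟨ 0 , i ⟩ else ⟨ 0 , suc i ⟩) n 0

shiftC-prim : Prim₁ shiftC
shiftC-prim pn = mapVars-prim {w = λ _ i d → if i <ᵇ d then ⟨ 0 , i ⟩ else ⟨ 0 , suc i ⟩}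
  (λ pi pd → if-prim (<ᵇ-prim pi pd) (⟨⟩-prim (const-prim 0) pi) (⟨⟩-prim (const-prim 0) (suc-prim pi)))
  pn (const-prim 0)

shiftC-⌜⌝ : ∀ t → shiftC ⌜ t ⌝ ≡ ⌜ ↑ t ⌝
shiftC-⌜⌝ t = mapVars-⌜⌝ {τ = shiftFrom} pushes vars t 0
  where
  pushes : ∀ d t → shiftFrom d t ≡ push shiftFrom d t
  pushes d (v i)   = refl
  pushes d bot     = refl
  pushes d 𝟎       = refl
  pushes d (𝐒 t)   = refl
  pushes d (t ≐ u) = refl
  pushes d (∼ t)   = refl
  pushes d (t ∨ u) = refl
  pushes d (ƛ t)   = refl
  pushes d (t · u) = refl
  pushes d 𝓡       = refl
  pushes d 𝓐       = refl
  vars : ∀ d i → (if i <ᵇ d then ⟨ 0 , i ⟩ else ⟨ 0 , suc i ⟩) ≡ ⌜ shiftFrom d (v i) ⌝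
  vars d i with <-cmp i d
  ... | tri< i<d _ _ rewrite <ᵇ-true i<d  = refl
  ... | tri≈ i≮d _ _ rewrite <ᵇ-false i≮d = refl
  ... | tri> i≮d _ _ rewrite <ᵇ-false i≮d = refl

iter-shiftC : ∀ s d → iter shiftC ⌜ s ⌝ d ≡ ⌜ iter ↑_ s d ⌝
iter-shiftC s zero    = refl
iter-shiftC s (suc d) = trans (cong shiftC (iter-shiftC s d)) (shiftC-⌜⌝ (iter ↑_ s d))

iter-shiftC-prim : Prim₂ (iter shiftC)
iter-shiftC-prim ps pd = iter-prim ps (shiftC-prim var₀) pd

substC : ℕ → ℕ → ℕ → ℕ
substC i s n = mapVars (λ j d → if j ≡ᵇ d + i then iter shiftC s d else ⟨ 0 , j ⟩) n 0

substC-prim : Prim₃ substC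
substC-prim {g = i} {s} pi ps pn =
  mapVars-prim {w = λ xs j d → if j ≡ᵇ d + i xs then iter shiftC (s xs) d else ⟨ 0 , j ⟩}
    (λ pj pd → if-prim (≡ᵇ-prim pj (+-prim pd (wk (wk pi)))) (iter-shiftC-prim (wk (wk ps)) pd)
                       (⟨⟩-prim (const-prim 0) pj))
    pn (const-prim 0)

substC-⌜⌝ : ∀ i s t → substC i ⌜ s ⌝ ⌜ t ⌝ ≡ ⌜ [ i ↦ s ] t ⌝
substC-⌜⌝ i s t = mapVars-⌜⌝ {τ = τ} pushes vars t 0
  where
  τ : ℕ → Term → Term
  -- Below `d` binders the variable has become `d + i` and the substituted term has been shifted `d`
  -- times. In this form the clause for `ƛ` holds by computation.
  τ d t = [ d + i ↦ iter ↑_ s d ] t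
  pushes : ∀ d t → τ d t ≡ push τ d t
  pushes d (v i)   = refl
  pushes d bot     = refl
  pushes d 𝟎       = refl
  pushes d (𝐒 t)   = refl
  pushes d (t ≐ u) = refl
  pushes d (∼ t)   = refl
  pushes d (t ∨ u) = refl
  pushes d (ƛ t)   = refl
  pushes d (t · u) = refl
  pushes d 𝓡       = refl
  pushes d 𝓐       = refl
  vars : ∀ d j → (if j ≡ᵇ d + i then iter shiftC ⌜ s ⌝ d else ⟨ 0 , j ⟩) ≡ ⌜ τ d (v j) ⌝
  vars d j with j ≡ᵇ d + i
  ... | true  = iter-shiftC s d
  ... | false = refl

instC : ℕ → ℕ → ℕ
instC s n = mapVars (λ j d → if j <ᵇ d then ⟨ 0 , j ⟩ else if j ≡ᵇ d then iter shiftC s d else ⟨ 0 , pred j ⟩) n 0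

instC-prim : Prim₂ instC
instC-prim {g = s} ps pn =
  mapVars-prim {w = λ xs j d → if j <ᵇ d then ⟨ 0 , j ⟩ else if j ≡ᵇ d then iter shiftC (s xs) d else ⟨ 0 , pred j ⟩}
    (λ pj pd → if-prim (<ᵇ-prim pj pd) (⟨⟩-prim (const-prim 0) pj)
               (if-prim (≡ᵇ-prim pj pd) (iter-shiftC-prim (wk (wk ps)) pd) (⟨⟩-prim (const-prim 0) (pred-prim pj))))
    pn (const-prim 0)

instC-⌜⌝ : ∀ s t → instC ⌜ s ⌝ ⌜ t ⌝ ≡ ⌜ t [ s ]ᵝ ⌝
instC-⌜⌝ s t = mapVars-⌜⌝ {τ = τ} pushes vars t 0
  where
  τ : ℕ → Term → Term
  τ d t = inst d (iter ↑_ s d) t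
  pushes : ∀ d t → τ d t ≡ push τ d t
  pushes d (v i)   = refl
  pushes d bot     = refl
  pushes d 𝟎       = refl
  pushes d (𝐒 t)   = refl
  pushes d (t ≐ u) = refl
  pushes d (∼ t)   = refl
  pushes d (t ∨ u) = refl
  pushes d (ƛ t)   = refl
  pushes d (t · u) = refl
  pushes d 𝓡       = refl
  pushes d 𝓐       = refl
  vars : ∀ d j → (if j <ᵇ d then ⟨ 0 , j ⟩ else if j ≡ᵇ d then iter shiftC ⌜ s ⌝ d else ⟨ 0 , pred j ⟩)
                 ≡ ⌜ τ d (v j) ⌝
  vars d j with <-cmp j d
  ... | tri< j<d _ _ rewrite <ᵇ-true j<d  = refl
  ... | tri≈ j≮d j≡d _ rewrite <ᵇ-false j≮d | ≡ᵇ-true j≡d = iter-shiftC s d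
  ... | tri> j≮d j≢d _ rewrite <ᵇ-false j≮d | ≡ᵇ-false j≢d = refl

-- Free variables

fvBody : ℕ → Body
fvBody i t x d A A′ B C = byShape t (χ (d + i ≡ᵇ x)) A′ A (χ ((B ≡ᵇ 1) || (C ≡ᵇ 1))) 0

isFree : ℕ → ℕ → Bool
isFree i n = termrec (fvBody i) n 0 ≡ᵇ 1

isFree-prim : PrimB₂ isFree
isFree-prim {g = i} pi pn = truth-prim (termrec-prim {b = λ xs → fvBody (i xs)}
  (λ pt px pd pA pA′ pB pC → byShape-prim pt
     (PrimB.indicator (≡ᵇ-prim (+-prim pd (wk (wk pi))) px)) pA′ pA
     (PrimB.indicator (truth-prim pB ||-prim truth-prim pC)) (const-prim 0))
  pn (const-prim 0))

isFree-⌜⌝ : ∀ i t → T (isFree i ⌜ t ⌝) ⇔ (i ∈fv t)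
isFree-⌜⌝ i t = go t 0
  where
  value : ℕ → ℕ → ℕ
  value = termrec (fvBody i)
  χ-⇔ : ∀ {n b} {P : Set} → n ≡ χ b → T b ⇔ P → T (n ≡ᵇ 1) ⇔ P
  χ-⇔ {b = b} refl eq = mk⇔ (to eq ∘ subst T (χ≡ᵇ1 b)) (subst T (sym (χ≡ᵇ1 b)) ∘ from eq)
  ≡-⇔ : ∀ {m n} {P : Set} → m ≡ n → T (n ≡ᵇ 1) ⇔ P → T (m ≡ᵇ 1) ⇔ P
  ≡-⇔ refl eq = eq
  none : ∀ {n} → n ≡ 0 → T (n ≡ᵇ 1) ⇔ T false
  none eq = χ-⇔ {b = false} eq (mk⇔ id id)
  either : ∀ {n} x y {P Q : Set} → n ≡ χ ((x ≡ᵇ 1) || (y ≡ᵇ 1)) →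
           T (x ≡ᵇ 1) ⇔ P → T (y ≡ᵇ 1) ⇔ Q → T (n ≡ᵇ 1) ⇔ (P ⊎ Q)
  either x y eq p q = χ-⇔ eq
    (mk⇔ (Sum.map (to p) (to q) ∘ to (T-∨ {x ≡ᵇ 1})) (from (T-∨ {x ≡ᵇ 1}) ∘ Sum.map (from p) (from q)))
  go : ∀ t d → T (value ⌜ t ⌝ d ≡ᵇ 1) ⇔ (d + i ∈fv t)
  go (v j)   d = χ-⇔ (termrec-⟨⟩ _ 0 j d) (mk⇔ (≡ᵇ⇒≡ (d + i) j) (≡⇒≡ᵇ (d + i) j))
  go bot     d = none (termrec-⟨⟩ _ 1 0 d)
  go 𝟎       d = none (termrec-⟨⟩ _ 2 0 d)
  go (𝐒 t)   d = ≡-⇔ (termrec-⟨⟩ _ 3 _ d) (go t d)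
  go (t ≐ u) d = either (value ⌜ t ⌝ d) (value ⌜ u ⌝ d) (termrec-⟨⟨⟩⟩ _ 4 _ _ d) (go t d) (go u d)
  go (∼ t)   d = ≡-⇔ (termrec-⟨⟩ _ 5 _ d) (go t d)
  go (t ∨ u) d = either (value ⌜ t ⌝ d) (value ⌜ u ⌝ d) (termrec-⟨⟨⟩⟩ _ 6 _ _ d) (go t d) (go u d)
  go (ƛ t)   d = ≡-⇔ (termrec-⟨⟩ _ 7 _ d) (go t (suc d))
  go (t · u) d = either (value ⌜ t ⌝ d) (value ⌜ u ⌝ d) (termrec-⟨⟨⟩⟩ _ 8 _ _ d) (go t d) (go u d)
  go 𝓡       d = none (termrec-⟨⟩ _ 9 0 d)
  go 𝓐       d = none (termrec-⟨⟩ _ 10 0 d)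

-- Head steps

numBody : Body
numBody t x d A A′ B C = if t ≡ᵇ 2 then 1 else if t ≡ᵇ 3 then A else 0

isNum : ℕ → Bool
isNum n = termrec numBody n 0 ≡ᵇ 1

isNum-prim : ∀ {n} {f : Vec ℕ n → ℕ} → Prim f → PrimB (λ xs → isNum (f xs))
isNum-prim pf = truth-prim (termrec-prim {b = λ _ → numBody}
  (λ pt px pd pA pA′ pB pC → if-prim (is-prim 2 pt) (const-prim 1) (if-prim (is-prim 3 pt) pA (const-prim 0)))
  pf (const-prim 0))

isNum-num : ∀ n → T (isNum ⌜ num n ⌝)
isNum-num zero    rewrite termrec-⟨⟩ numBody 2 0 0 = _
isNum-num (suc n) rewrite termrec-⟨⟩ numBody 3 ⌜ num n ⌝ 0 = isNum-num n

isNum-sound : ∀ t → T (isNum ⌜ t ⌝) → ∃[ n ] t ≡ num n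
isNum-sound 𝟎 h = 0 , refl
isNum-sound (𝐒 t) h rewrite termrec-⟨⟩ numBody 3 ⌜ t ⌝ 0 with n , refl ← isNum-sound t h = suc n , refl
isNum-sound (v i)   h rewrite termrec-⟨⟩ numBody 0 i 0  = contradiction h id
isNum-sound bot     h rewrite termrec-⟨⟩ numBody 1 0 0  = contradiction h id
isNum-sound (t ≐ u) h rewrite termrec-⟨⟩ numBody 4 ⟨ ⌜ t ⌝ , ⌜ u ⌝ ⟩ 0 = contradiction h id
isNum-sound (∼ t)   h rewrite termrec-⟨⟩ numBody 5 ⌜ t ⌝ 0 = contradiction h id
isNum-sound (t ∨ u) h rewrite termrec-⟨⟩ numBody 6 ⟨ ⌜ t ⌝ , ⌜ u ⌝ ⟩ 0 = contradiction h id
isNum-sound (ƛ t)   h rewrite termrec-⟨⟩ numBody 7 ⌜ t ⌝ 0 = contradiction h id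
isNum-sound (t · u) h rewrite termrec-⟨⟩ numBody 8 ⟨ ⌜ t ⌝ , ⌜ u ⌝ ⟩ 0 = contradiction h id
isNum-sound 𝓡       h rewrite termrec-⟨⟩ numBody 9 0 0  = contradiction h id
isNum-sound 𝓐       h rewrite termrec-⟨⟩ numBody 10 0 0 = contradiction h id

infixl 9 _·ᶜ_

_·ᶜ_ : ℕ → ℕ → ℕ
x ·ᶜ y = ⟨ 8 , ⟨ x , y ⟩ ⟩

·ᶜ-prim : Prim₂ _·ᶜ_
·ᶜ-prim p q = ⟨⟩-prim (const-prim 8) (⟨⟩-prim p q)

fun opd : ℕ → ℕ
fun n = π₁ (π₂ n)
opd n = π₂ (π₂ n)

fun-·ᶜ : ∀ x y → fun (x ·ᶜ y) ≡ x
fun-·ᶜ x y = trans (cong π₁ (π₂-⟨⟩ 8 _)) (π₁-⟨⟩ x y)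

opd-·ᶜ : ∀ x y → opd (x ·ᶜ y) ≡ y
opd-·ᶜ x y = trans (cong π₂ (π₂-⟨⟩ 8 _)) (π₂-⟨⟩ x y)

opd-prim : Prim₁ opd
opd-prim p = π₂-prim (π₂-prim p)

fun-prim : Prim₁ fun
fun-prim p = π₁-prim (π₂-prim p)

𝓡ᶜ : ℕ → ℕ → ℕ
𝓡ᶜ g h = ⟨ 9 , 0 ⟩ ·ᶜ g ·ᶜ h

𝓡ᶜ-prim : Prim₂ 𝓡ᶜ
𝓡ᶜ-prim pg ph = ·ᶜ-prim (·ᶜ-prim (⟨⟩-prim (const-prim 9) (const-prim 0)) pg) ph

-- A shape is tested by rebuilding the number from its projections; success is an equation between
-- codes, from which the shape of the term can be read off.
isƛ isRec isSuc : ℕ → Bool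
isƛ a   = a ≡ᵇ ⟨ 7 , π₂ a ⟩
isRec a = a ≡ᵇ 𝓡ᶜ (opd (fun a)) (opd a)
isSuc c = (c ≡ᵇ ⟨ 3 , π₂ c ⟩) && isNum (π₂ c)

-- The code of a contractum of a · c, given the code B of one of a; 0 if there
-- is none.
contract : ℕ → ℕ → ℕ → ℕ
contract a c B =
  if isƛ a then instC c (π₂ a) else
  if isRec a then
    (if c ≡ᵇ ⟨ 2 , 0 ⟩ then opd (fun a) else
     if isSuc c then opd a ·ᶜ π₂ c ·ᶜ (a ·ᶜ π₂ c) else 0) else
  if B ≡ᵇ 0 then 0 else B ·ᶜ c

contract-prim : Prim₃ contract
contract-prim pa pc pB =
  if-prim (≡ᵇ-prim pa (⟨⟩-prim (const-prim 7) (π₂-prim pa))) (instC-prim pc (π₂-prim pa))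
  (if-prim (≡ᵇ-prim pa (𝓡ᶜ-prim (opd-prim (fun-prim pa)) (opd-prim pa)))
    (if-prim (≡ᵇ-prim pc (⟨⟩-prim (const-prim 2) (const-prim 0))) (opd-prim (fun-prim pa))
    (if-prim (≡ᵇ-prim pc (⟨⟩-prim (const-prim 3) (π₂-prim pc)) &&-prim isNum-prim (π₂-prim pc))
      (·ᶜ-prim (·ᶜ-prim (opd-prim pa) (π₂-prim pc)) (·ᶜ-prim pa (π₂-prim pc))) (const-prim 0)))
  (if-prim (is-prim 0 pB) (const-prim 0) (·ᶜ-prim pB pc)))

headStepBody : Body
headStepBody t x d A A′ B C = if t ≡ᵇ 8 then contract (π₁ x) (π₂ x) B else 0

headStep : ℕ → ℕ
headStep n = termrec headStepBody n 0

headStep-prim : Prim₁ headStep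
headStep-prim pn = termrec-prim {b = λ _ → headStepBody}
  (λ pt px pd pA pA′ pB pC → if-prim (is-prim 8 pt) (contract-prim (π₁-prim px) (π₂-prim px) pB) (const-prim 0))
  pn (const-prim 0)

headStep-· : ∀ a c → headStep (a ·ᶜ c) ≡ contract a c (headStep a)
headStep-· a c rewrite termrec-⟨⟨⟩⟩ headStepBody 8 a c 0 | π₁-⟨⟩ a c | π₂-⟨⟩ a c = refl

isƛ-⌜⌝ : ∀ t → T (isƛ ⌜ t ⌝) ⇔ (∃[ b ] t ≡ (ƛ b))
isƛ-⌜⌝ t = mk⇔ sound λ { (b , refl) → ≡⇒≡ᵇ _ _ (cong (⟨ 7 ,_⟩) (sym (π₂-⟨⟩ 7 ⌜ b ⌝))) }
  where
  sound : T (isƛ ⌜ t ⌝) → ∃[ b ] t ≡ (ƛ b)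
  sound h with b , eq , _ ← ƛ-view t (≡ᵇ⇒≡ _ _ h) = b , eq

isRec-⌜⌝ : ∀ t → T (isRec ⌜ t ⌝) ⇔ (∃₂ λ g h → t ≡ 𝓡 · g · h)
isRec-⌜⌝ t = mk⇔ sound λ { (g , h , refl) → ≡⇒≡ᵇ _ _ (sym (cong₂ 𝓡ᶜ
    (trans (cong opd (fun-·ᶜ ⌜ 𝓡 · g ⌝ ⌜ h ⌝)) (opd-·ᶜ ⌜ 𝓡 ⌝ ⌜ g ⌝)) (opd-·ᶜ ⌜ 𝓡 · g ⌝ ⌜ h ⌝))) }
  where
  sound : T (isRec ⌜ t ⌝) → ∃₂ λ g h → t ≡ 𝓡 · g · h
  sound e with s , h , refl , es , _ ← ·-view t (≡ᵇ⇒≡ _ _ e)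
          with r , g , refl , er , _ ← ·-view s es
          with refl ← ⌜⌝-injective {r} {𝓡} er = g , h , refl

isSuc-⌜⌝ : ∀ t → T (isSuc ⌜ t ⌝) ⇔ (∃[ n ] t ≡ 𝐒 num n)
isSuc-⌜⌝ t = mk⇔ sound λ { (n , refl) → from T-∧
    ( ≡⇒≡ᵇ _ _ (cong (⟨ 3 ,_⟩) (sym (π₂-⟨⟩ 3 ⌜ num n ⌝)))
    , subst (T ∘ isNum) (sym (π₂-⟨⟩ 3 ⌜ num n ⌝)) (isNum-num n)) }
  where
  sound : T (isSuc ⌜ t ⌝) → ∃[ n ] t ≡ 𝐒 num n
  sound e with e₁ , e₂ ← to T-∧ e
          with u , refl , eu ← 𝐒-view t (≡ᵇ⇒≡ _ _ e₁)
          with n , refl ← isNum-sound u (subst (T ∘ isNum) (sym eu) e₂) = n , refl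

-- Together with `¬𝓡··▷`, this makes the cases of `contract` exclusive: a function part that itself
-- steps is neither an abstraction nor a recursor with two arguments. So head reduction is
-- deterministic and can be computed by a function.
¬ƛ▷ : ∀ {t t′} → t ▷ t′ → ¬ (∃[ b ] t ≡ (ƛ b))
¬ƛ▷ () (b , refl)

¬𝓡··▷ : ∀ {t t′} → t ▷ t′ → ¬ (∃₂ λ g h → t ≡ 𝓡 · g · h)
¬𝓡··▷ (app _ (app _ ())) (g , h , refl)

headStep-complete : ∀ {t t′} → t ▷ t′ → headStep ⌜ t ⌝ ≡ ⌜ t′ ⌝
headStep-complete (β b t)
  rewrite headStep-· ⌜ ƛ b ⌝ ⌜ t ⌝ | T⇒≡true (from (isƛ-⌜⌝ (ƛ b)) (b , refl)) | π₂-⟨⟩ 7 ⌜ b ⌝ = instC-⌜⌝ t b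
headStep-complete (𝓡𝟎 g h)
  rewrite headStep-· ⌜ 𝓡 · g · h ⌝ ⌜ 𝟎 ⌝
        | ¬T⇒≡false ((λ ()) ∘ proj₂ ∘ to (isƛ-⌜⌝ (𝓡 · g · h)))
        | T⇒≡true (from (isRec-⌜⌝ (𝓡 · g · h)) (g , h , refl))
        | ≡ᵇ-true {⟨ 2 , 0 ⟩} refl
  = trans (cong opd (fun-·ᶜ ⌜ 𝓡 · g ⌝ ⌜ h ⌝)) (opd-·ᶜ ⌜ 𝓡 ⌝ ⌜ g ⌝)
headStep-complete (𝓡𝐒 g h n)
  rewrite headStep-· ⌜ 𝓡 · g · h ⌝ ⌜ 𝐒 num n ⌝
        | ¬T⇒≡false ((λ ()) ∘ proj₂ ∘ to (isƛ-⌜⌝ (𝓡 · g · h)))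
        | T⇒≡true (from (isRec-⌜⌝ (𝓡 · g · h)) (g , h , refl))
        | ≡ᵇ-false {⟨ 3 , ⌜ num n ⌝ ⟩} {⟨ 2 , 0 ⟩} ((λ ()) ∘ proj₁ ∘ ⟨⟩-injective)
        | T⇒≡true (from (isSuc-⌜⌝ (𝐒 num n)) (n , refl))
  = cong₂ (λ h′ m → h′ ·ᶜ m ·ᶜ (⌜ 𝓡 · g · h ⌝ ·ᶜ m)) (opd-·ᶜ ⌜ 𝓡 · g ⌝ ⌜ h ⌝) (π₂-⟨⟩ 3 ⌜ num n ⌝)
headStep-complete (app {t} {t′} u r)
  rewrite headStep-· ⌜ t ⌝ ⌜ u ⌝
        | ¬T⇒≡false {isƛ ⌜ t ⌝} (λ e → ¬ƛ▷ r (to (isƛ-⌜⌝ t) e))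
        | ¬T⇒≡false {isRec ⌜ t ⌝} (λ e → ¬𝓡··▷ r (to (isRec-⌜⌝ t) e))
        | headStep-complete r
        | ≡ᵇ-false (⌜⌝≢0 t′) = refl

-- Failure is the value 0, which is not the code of `t′`. In the remaining cases injectivity of
-- codes identifies `t′` with the contractum.
headStep-sound : ∀ t {t′} → headStep ⌜ t ⌝ ≡ ⌜ t′ ⌝ → t ▷ t′
headStep-sound (t · u) {t′} eq rewrite headStep-· ⌜ t ⌝ ⌜ u ⌝
  with isƛ ⌜ t ⌝ | to (isƛ-⌜⌝ t)
... | true | lam with b , refl ← lam _
      rewrite π₂-⟨⟩ 7 ⌜ b ⌝ | instC-⌜⌝ u b with refl ← ⌜⌝-injective {b [ u ]ᵝ} {t′} eq = β b u
... | false | _ with isRec ⌜ t ⌝ | to (isRec-⌜⌝ t)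
...   | false | _ with headStep ⌜ t ⌝ | headStep-sound t
...     | zero  | _ = contradiction (sym eq) (⌜⌝≢0 t′)
...     | suc B | sound with s , r , refl , es , er ← ·-view t′ (sym eq)
          with refl ← ⌜⌝-injective {r} {u} er = app u (sound (sym es))
headStep-sound (t · u) {t′} eq | false | _ | true | recur with g , h , refl ← recur _
  with ⌜ u ⌝ ≡ᵇ ⟨ 2 , 0 ⟩ in e₀
... | true rewrite fun-·ᶜ ⌜ 𝓡 · g ⌝ ⌜ h ⌝ | opd-·ᶜ ⌜ 𝓡 ⌝ ⌜ g ⌝
      with refl ← ⌜⌝-injective {g} {t′} eq
      with refl ← ⌜⌝-injective {u} {𝟎} (≡ᵇ⇒≡ _ _ (subst T (sym e₀) _)) = 𝓡𝟎 g h
... | false with isSuc ⌜ u ⌝ | to (isSuc-⌜⌝ u)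
...   | false | _ = contradiction (sym eq) (⌜⌝≢0 t′)
...   | true  | numeral with n , refl ← numeral _
        rewrite opd-·ᶜ ⌜ 𝓡 · g ⌝ ⌜ h ⌝ | π₂-⟨⟩ 3 ⌜ num n ⌝
        with refl ← ⌜⌝-injective {h · num n · (𝓡 · g · h · num n)} {t′} eq = 𝓡𝐒 g h n
headStep-sound (v i)   {t′} eq = contradiction (trans (sym eq) (termrec-⟨⟩ headStepBody 0 i 0)) (⌜⌝≢0 t′)
headStep-sound bot     {t′} eq = contradiction (trans (sym eq) (termrec-⟨⟩ headStepBody 1 0 0)) (⌜⌝≢0 t′)
headStep-sound 𝟎       {t′} eq = contradiction (trans (sym eq) (termrec-⟨⟩ headStepBody 2 0 0)) (⌜⌝≢0 t′)
headStep-sound (𝐒 t)   {t′} eq = contradiction (trans (sym eq) (termrec-⟨⟩ headStepBody 3 _ 0)) (⌜⌝≢0 t′)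
headStep-sound (t ≐ u) {t′} eq = contradiction (trans (sym eq) (termrec-⟨⟩ headStepBody 4 _ 0)) (⌜⌝≢0 t′)
headStep-sound (∼ t)   {t′} eq = contradiction (trans (sym eq) (termrec-⟨⟩ headStepBody 5 _ 0)) (⌜⌝≢0 t′)
headStep-sound (t ∨ u) {t′} eq = contradiction (trans (sym eq) (termrec-⟨⟩ headStepBody 6 _ 0)) (⌜⌝≢0 t′)
headStep-sound (ƛ t)   {t′} eq = contradiction (trans (sym eq) (termrec-⟨⟩ headStepBody 7 _ 0)) (⌜⌝≢0 t′)
headStep-sound 𝓡       {t′} eq = contradiction (trans (sym eq) (termrec-⟨⟩ headStepBody 9 0 0)) (⌜⌝≢0 t′)
headStep-sound 𝓐       {t′} eq = contradiction (trans (sym eq) (termrec-⟨⟩ headStepBody 10 0 0)) (⌜⌝≢0 t′)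

mapSet-⌜⌝ᶜ : ∀ {f F} → (∀ t → f ⌜ t ⌝ ≡ ⌜ F t ⌝) → ∀ Γ → mapSet f ⌜ Γ ⌝ᶜ ≡ ⌜ map F Γ ⌝ᶜ
mapSet-⌜⌝ᶜ {f} {F} eq Γ = trans (mapSet-codeSet f (map ⌜_⌝ Γ)) (cong codeSet (begin
  map f (map ⌜_⌝ Γ)   ≡⟨ map-∘ Γ ⟨
  map (f ∘ ⌜_⌝) Γ     ≡⟨ map-cong eq Γ ⟩
  map (⌜_⌝ ∘ F) Γ     ≡⟨ map-∘ Γ ⟩
  map ⌜_⌝ (map F Γ)   ∎))
  where open ≡-Reasoning

T-not : ∀ b → T (not b) ⇔ (¬ T b)
T-not true  = mk⇔ (λ ()) (λ h → h _)
T-not false = mk⇔ (λ _ ()) (λ _ → _)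

-- Rule schemas

data Sort : Set where
  term index : Sort

Value : Sort → Set
Value term  = Term
Value index = ℕ

codeValue : ∀ s → Value s → ℕ
codeValue term  t = ⌜ t ⌝
codeValue index i = i

Env : List Sort → Set
Env []       = ⊤
Env (s ∷ ss) = Value s × Env ss

codeEnv : ∀ ss → Env ss → List ℕ
codeEnv []       ρ       = []
codeEnv (s ∷ ss) (x , ρ) = codeValue s x ∷ codeEnv ss ρ

value : ∀ {s ss} → s ∈ ss → Env ss → Value s
value (here refl) (x , ρ) = x
value (there i)   (x , ρ) = value i ρ

position : ∀ {s : Sort} {ss} → s ∈ ss → ℕ
position (here _)  = 0
position (there i) = suc (position i)

infixl 9 _·ᵉ_
infixr 8 𝐒ᵉ_ ∼ᵉ_
infix  7 _≐ᵉ_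
infix  6 _𝐍ᵉ _𝐁ᵉ
infixr 5 _∨ᵉ_ _∷ᵉ_
infixr 4 ƛᵉ_
infixr 10 ↑ᵉ_
infix 3 _⊢ᵉ_

-- Exactly the operations that occur in rules. Facts about the readings are proved by induction on
-- expressions, hence once for all 43 rules.
data TermExp (ss : List Sort) : Set where
  var   : term ∈ ss → TermExp ss
  vᵉ    : index ∈ ss → TermExp ss
  con   : Term → TermExp ss
  𝐒ᵉ_   : TermExp ss → TermExp ss
  _≐ᵉ_  : TermExp ss → TermExp ss → TermExp ss
  ∼ᵉ_   : TermExp ss → TermExp ss
  _∨ᵉ_  : TermExp ss → TermExp ss → TermExp ss
  ƛᵉ_   : TermExp ss → TermExp ss
  _·ᵉ_  : TermExp ss → TermExp ss → TermExp ss
  ↑ᵉ_   : TermExp ss → TermExp ss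
  substᵉ : index ∈ ss → TermExp ss → TermExp ss → TermExp ss

data CtxExp (ss : List Sort) : Set where
  Γᵉ      : CtxExp ss
  _∷ᵉ_    : TermExp ss → CtxExp ss → CtxExp ss
  ↑Γᵉ     : CtxExp ss
  substΓᵉ : index ∈ ss → TermExp ss → CtxExp ss

data JudgmentExp (ss : List Sort) : Set where
  _⊢ᵉ_ : CtxExp ss → TermExp ss → JudgmentExp ss

data Side (ss : List Sort) : Set where
  none  : Side ss
  fresh : index ∈ ss → Side ss
  steps : term ∈ ss → term ∈ ss → Side ss

module _ {ss : List Sort} where

  ⟦_⟧ᵗ : TermExp ss → Env ss → Term
  ⟦ var x ⟧ᵗ        ρ = value x ρ
  ⟦ vᵉ i ⟧ᵗ         ρ = v (value i ρ)
  ⟦ con t ⟧ᵗ        ρ = t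
  ⟦ 𝐒ᵉ e ⟧ᵗ         ρ = 𝐒 ⟦ e ⟧ᵗ ρ
  ⟦ e ≐ᵉ e′ ⟧ᵗ      ρ = ⟦ e ⟧ᵗ ρ ≐ ⟦ e′ ⟧ᵗ ρ
  ⟦ ∼ᵉ e ⟧ᵗ         ρ = ∼ ⟦ e ⟧ᵗ ρ
  ⟦ e ∨ᵉ e′ ⟧ᵗ      ρ = ⟦ e ⟧ᵗ ρ ∨ ⟦ e′ ⟧ᵗ ρ
  ⟦ ƛᵉ e ⟧ᵗ         ρ = ƛ ⟦ e ⟧ᵗ ρ
  ⟦ e ·ᵉ e′ ⟧ᵗ      ρ = ⟦ e ⟧ᵗ ρ · ⟦ e′ ⟧ᵗ ρ
  ⟦ ↑ᵉ e ⟧ᵗ         ρ = ↑ ⟦ e ⟧ᵗ ρ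
  ⟦ substᵉ i e e′ ⟧ᵗ ρ = [ value i ρ ↦ ⟦ e ⟧ᵗ ρ ] ⟦ e′ ⟧ᵗ ρ

  ⟦_⟧ᶜ : CtxExp ss → Ctx → Env ss → Ctx
  ⟦ Γᵉ ⟧ᶜ          Γ ρ = Γ
  ⟦ e ∷ᵉ c ⟧ᶜ      Γ ρ = ⟦ e ⟧ᵗ ρ ∷ ⟦ c ⟧ᶜ Γ ρ
  ⟦ ↑Γᵉ ⟧ᶜ         Γ ρ = map ↑_ Γ
  ⟦ substΓᵉ i e ⟧ᶜ Γ ρ = map ([ value i ρ ↦ ⟦ e ⟧ᵗ ρ ]_) Γ

  ⟦_⟧ʲ : JudgmentExp ss → Ctx → Env ss → Judgment
  ⟦ c ⊢ᵉ e ⟧ʲ Γ ρ = ⟦ c ⟧ᶜ Γ ρ ⊢ ⟦ e ⟧ᵗ ρ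

  Holds : Side ss → Ctx → Env ss → Set
  Holds none         Γ ρ = ⊤
  Holds (fresh i)    Γ ρ = All (λ t → ¬ (value i ρ ∈fv t)) Γ
  Holds (steps c c′) Γ ρ = value c ρ ▷ value c′ ρ

  -- On codes, an environment is read by a function from positions.
  codeᵗ : TermExp ss → (ℕ → ℕ) → ℕ
  codeᵗ (var x)         f = f (position x)
  codeᵗ (vᵉ i)          f = ⟨ 0 , f (position i) ⟩
  codeᵗ (con t)         f = ⌜ t ⌝
  codeᵗ (𝐒ᵉ e)          f = ⟨ 3 , codeᵗ e f ⟩
  codeᵗ (e ≐ᵉ e′)       f = ⟨ 4 , ⟨ codeᵗ e f , codeᵗ e′ f ⟩ ⟩
  codeᵗ (∼ᵉ e)          f = ⟨ 5 , codeᵗ e f ⟩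
  codeᵗ (e ∨ᵉ e′)       f = ⟨ 6 , ⟨ codeᵗ e f , codeᵗ e′ f ⟩ ⟩
  codeᵗ (ƛᵉ e)          f = ⟨ 7 , codeᵗ e f ⟩
  codeᵗ (e ·ᵉ e′)       f = ⟨ 8 , ⟨ codeᵗ e f , codeᵗ e′ f ⟩ ⟩
  codeᵗ (↑ᵉ e)          f = shiftC (codeᵗ e f)
  codeᵗ (substᵉ i e e′) f = substC (f (position i)) (codeᵗ e f) (codeᵗ e′ f)

  codeᶜ : CtxExp ss → ℕ → (ℕ → ℕ) → ℕ
  codeᶜ Γᵉ            G f = G
  codeᶜ (e ∷ᵉ c)      G f = insert (codeᵗ e f) (codeᶜ c G f)
  codeᶜ ↑Γᵉ           G f = mapSet shiftC G
  codeᶜ (substΓᵉ i e) G f = mapSet (substC (f (position i)) (codeᵗ e f)) G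

  codeʲ : JudgmentExp ss → ℕ → (ℕ → ℕ) → ℕ
  codeʲ (c ⊢ᵉ e) G f = ⟨ codeᶜ c G f , codeᵗ e f ⟩

  holds : Side ss → ℕ → (ℕ → ℕ) → Bool
  holds none         G f = true
  holds (fresh i)    G f = all∈ (λ n → not (isFree (f (position i)) n)) G
  holds (steps c c′) G f = headStep (f (position c)) ≡ᵇ f (position c′)

  Reads : (ℕ → ℕ) → Env ss → Set
  Reads f ρ = ∀ {s} (x : s ∈ ss) → f (position x) ≡ codeValue s (value x ρ)

  module _ {f : ℕ → ℕ} {ρ : Env ss} (reads : Reads f ρ) where

    codeᵗ-⌜⌝ : ∀ e → codeᵗ e f ≡ ⌜ ⟦ e ⟧ᵗ ρ ⌝
    codeᵗ-⌜⌝ (var x)         = reads x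
    codeᵗ-⌜⌝ (vᵉ i)          = cong (⟨ 0 ,_⟩) (reads i)
    codeᵗ-⌜⌝ (con t)         = refl
    codeᵗ-⌜⌝ (𝐒ᵉ e)          = cong (⟨ 3 ,_⟩) (codeᵗ-⌜⌝ e)
    codeᵗ-⌜⌝ (e ≐ᵉ e′)       = cong₂ (λ x y → ⟨ 4 , ⟨ x , y ⟩ ⟩) (codeᵗ-⌜⌝ e) (codeᵗ-⌜⌝ e′)
    codeᵗ-⌜⌝ (∼ᵉ e)          = cong (⟨ 5 ,_⟩) (codeᵗ-⌜⌝ e)
    codeᵗ-⌜⌝ (e ∨ᵉ e′)       = cong₂ (λ x y → ⟨ 6 , ⟨ x , y ⟩ ⟩) (codeᵗ-⌜⌝ e) (codeᵗ-⌜⌝ e′)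
    codeᵗ-⌜⌝ (ƛᵉ e)          = cong (⟨ 7 ,_⟩) (codeᵗ-⌜⌝ e)
    codeᵗ-⌜⌝ (e ·ᵉ e′)       = cong₂ _·ᶜ_ (codeᵗ-⌜⌝ e) (codeᵗ-⌜⌝ e′)
    codeᵗ-⌜⌝ (↑ᵉ e)          = trans (cong shiftC (codeᵗ-⌜⌝ e)) (shiftC-⌜⌝ (⟦ e ⟧ᵗ ρ))
    codeᵗ-⌜⌝ (substᵉ i e e′)
      rewrite reads i | codeᵗ-⌜⌝ e | codeᵗ-⌜⌝ e′ = substC-⌜⌝ (value i ρ) (⟦ e ⟧ᵗ ρ) (⟦ e′ ⟧ᵗ ρ)

    codeᶜ-⌜⌝ : ∀ c Γ → codeᶜ c ⌜ Γ ⌝ᶜ f ≡ ⌜ ⟦ c ⟧ᶜ Γ ρ ⌝ᶜ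
    codeᶜ-⌜⌝ Γᵉ            Γ = refl
    codeᶜ-⌜⌝ (e ∷ᵉ c)      Γ =
      trans (cong₂ insert (codeᵗ-⌜⌝ e) (codeᶜ-⌜⌝ c Γ)) (insert-codeSet _ (map ⌜_⌝ (⟦ c ⟧ᶜ Γ ρ)))
    codeᶜ-⌜⌝ ↑Γᵉ           Γ = mapSet-⌜⌝ᶜ shiftC-⌜⌝ Γ
    codeᶜ-⌜⌝ (substΓᵉ i e) Γ
      rewrite reads i | codeᵗ-⌜⌝ e = mapSet-⌜⌝ᶜ (substC-⌜⌝ (value i ρ) (⟦ e ⟧ᵗ ρ)) Γ

    codeʲ-⌜⌝ : ∀ J Γ → codeʲ J ⌜ Γ ⌝ᶜ f ≡ ⌜ ⟦ J ⟧ʲ Γ ρ ⌝ʲ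
    codeʲ-⌜⌝ (c ⊢ᵉ e) Γ = cong₂ ⟨_,_⟩ (codeᶜ-⌜⌝ c Γ) (codeᵗ-⌜⌝ e)

    holds-⌜⌝ : ∀ S Γ → T (holds S ⌜ Γ ⌝ᶜ f) ⇔ Holds S Γ ρ
    holds-⌜⌝ none         Γ = mk⇔ id id
    holds-⌜⌝ (fresh i)    Γ rewrite reads i = mk⇔
      (λ h → All.map (λ {t} n → to (T-not _) n ∘ from (isFree-⌜⌝ _ t))
                     (All.map⁻ (to (all∈-codeSet _ (map ⌜_⌝ Γ)) h)))
      (λ h → from (all∈-codeSet _ (map ⌜_⌝ Γ))
               (All.map⁺ (All.map (λ {t} n → from (T-not _) (n ∘ to (isFree-⌜⌝ _ t))) h)))
    holds-⌜⌝ (steps c c′) Γ rewrite reads c | reads c′ = mk⇔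
      (headStep-sound (value c ρ) ∘ ≡ᵇ⇒≡ _ _)
      (≡⇒≡ᵇ _ _ ∘ headStep-complete)

  module _ {n : ℕ} {f : Vec ℕ n → ℕ → ℕ} (pf : ∀ k → Prim (λ xs → f xs k)) where

    -- An expression looks up only fixed positions, so `f` has to be primitive recursive in `xs` at
    -- each position separately.
    codeᵗ-prim : ∀ e → Prim (λ xs → codeᵗ e (f xs))
    codeᵗ-prim (var x)         = pf (position x)
    codeᵗ-prim (vᵉ i)          = ⟨⟩-prim (const-prim 0) (pf (position i))
    codeᵗ-prim (con t)         = const-prim ⌜ t ⌝
    codeᵗ-prim (𝐒ᵉ e)          = ⟨⟩-prim (const-prim 3) (codeᵗ-prim e)
    codeᵗ-prim (e ≐ᵉ e′)       = ⟨⟩-prim (const-prim 4) (⟨⟩-prim (codeᵗ-prim e) (codeᵗ-prim e′))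
    codeᵗ-prim (∼ᵉ e)          = ⟨⟩-prim (const-prim 5) (codeᵗ-prim e)
    codeᵗ-prim (e ∨ᵉ e′)       = ⟨⟩-prim (const-prim 6) (⟨⟩-prim (codeᵗ-prim e) (codeᵗ-prim e′))
    codeᵗ-prim (ƛᵉ e)          = ⟨⟩-prim (const-prim 7) (codeᵗ-prim e)
    codeᵗ-prim (e ·ᵉ e′)       = ·ᶜ-prim (codeᵗ-prim e) (codeᵗ-prim e′)
    codeᵗ-prim (↑ᵉ e)          = shiftC-prim (codeᵗ-prim e)
    codeᵗ-prim (substᵉ i e e′) = substC-prim (pf (position i)) (codeᵗ-prim e) (codeᵗ-prim e′)

    codeᶜ-prim : ∀ {G : Vec ℕ n → ℕ} → Prim G → ∀ c → Prim (λ xs → codeᶜ c (G xs) (f xs))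
    codeᶜ-prim pG Γᵉ            = pG
    codeᶜ-prim pG (e ∷ᵉ c)      = insert-prim (codeᵗ-prim e) (codeᶜ-prim pG c)
    codeᶜ-prim pG ↑Γᵉ           = mapSet-prim (shiftC-prim var₀) pG
    codeᶜ-prim pG (substΓᵉ i e) =
      mapSet-prim (substC-prim (wk (pf (position i))) (wk (codeᵗ-prim e)) var₀) pG

    codeʲ-prim : ∀ {G : Vec ℕ n → ℕ} → Prim G → ∀ J → Prim (λ xs → codeʲ J (G xs) (f xs))
    codeʲ-prim pG (c ⊢ᵉ e) = ⟨⟩-prim (codeᶜ-prim pG c) (codeᵗ-prim e)

    holds-prim : ∀ {G : Vec ℕ n → ℕ} → Prim G → ∀ S → PrimB (λ xs → holds S (G xs) (f xs))
    holds-prim pG none         = constB-prim true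
    holds-prim pG (fresh i)    =
      all∈-prim (not-prim (isFree-prim (wk (pf (position i))) var₀)) pG
    holds-prim pG (steps c c′) = ≡ᵇ-prim (headStep-prim (pf (position c))) (pf (position c′))

-- The rules of OGA as schemas.

_𝐍ᵉ _𝐁ᵉ : ∀ {ss} → TermExp ss → TermExp ss
e 𝐍ᵉ = e ≐ᵉ e
e 𝐁ᵉ = e ∨ᵉ (∼ᵉ e)

_≠ᵉ_ _∧ᵉ_ : ∀ {ss} → TermExp ss → TermExp ss → TermExp ss
e ≠ᵉ e′ = ∼ᵉ (e ≐ᵉ e′)
e ∧ᵉ e′ = ∼ᵉ ((∼ᵉ e) ∨ᵉ (∼ᵉ e′))

-- The field `derive` serves soundness of the checker: data that pass the tests give a genuine
-- instance whose annotation is the one in the proof code. The converse is `toInstance`.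
record Rule : Set where
  constructor rule
  field
    number     : ℕ
    sorts      : List Sort
    side       : Side sorts
    premises   : List (JudgmentExp sorts)
    conclusion : JudgmentExp sorts
    derive     : ∀ Γ ρ → Holds side Γ ρ →
                 Σ[ r ∈ map (λ J → ⟦ J ⟧ʲ Γ ρ) premises ⟹ ⟦ conclusion ⟧ʲ Γ ρ ]
                   annotation r ≡ number ∷ ⌜ Γ ⌝ᶜ ∷ codeEnv sorts ρ

pattern #0 = here refl
pattern #1 = there #0
pattern #2 = there #1
pattern #3 = there #2

pattern x₀ = var #0
pattern x₁ = var #1
pattern x₂ = var #2
pattern x₃ = var #3

𝓡ᵉ : ∀ {ss} → TermExp ss → TermExp ss → TermExp ss → TermExp ss
𝓡ᵉ g h m = con 𝓡 ·ᵉ g ·ᵉ h ·ᵉ m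

v₀ : ∀ {ss} → TermExp ss
v₀ = con (v 0)

terms : ℕ → List Sort
terms k = replicate k term

opaque
  rules : List Rule
  rules =
    rule 0 (terms 1) none [] (x₀ ∷ᵉ Γᵉ ⊢ᵉ x₀) (λ { Γ (c , _) _ → hyp Γ c , refl }) ∷
    rule 1 (terms 2) none ((Γᵉ ⊢ᵉ x₁) ∷ []) (x₀ ∷ᵉ Γᵉ ⊢ᵉ x₁) (λ { Γ (a , c , _) _ → weak Γ a c , refl }) ∷
    rule 2 (terms 2) none ((Γᵉ ⊢ᵉ x₀) ∷ (x₀ ∷ᵉ Γᵉ ⊢ᵉ x₁) ∷ []) (Γᵉ ⊢ᵉ x₁)
      (λ { Γ (a , c , _) _ → cut Γ a c , refl }) ∷
    rule 3 (term ∷ index ∷ term ∷ []) none ((Γᵉ ⊢ᵉ x₀) ∷ []) (substΓᵉ #1 x₂ ⊢ᵉ substᵉ #1 x₂ x₀)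
      (λ { Γ (c , i , s , _) _ → sub Γ c i s , refl }) ∷
    rule 4 (terms 1) none ((Γᵉ ⊢ᵉ x₀) ∷ []) (Γᵉ ⊢ᵉ x₀ ≐ᵉ con (num 1)) (λ { Γ (a , _) _ → =1I Γ a , refl }) ∷
    rule 5 (terms 1) none ((Γᵉ ⊢ᵉ x₀ ≐ᵉ con (num 1)) ∷ []) (Γᵉ ⊢ᵉ x₀) (λ { Γ (a , _) _ → =1E Γ a , refl }) ∷
    rule 6 (terms 1) none ((Γᵉ ⊢ᵉ ∼ᵉ x₀) ∷ []) (Γᵉ ⊢ᵉ x₀ ≐ᵉ con (num 0)) (λ { Γ (a , _) _ → =0I Γ a , refl }) ∷
    rule 7 (terms 1) none ((Γᵉ ⊢ᵉ x₀ ≐ᵉ con (num 0)) ∷ []) (Γᵉ ⊢ᵉ ∼ᵉ x₀) (λ { Γ (a , _) _ → =0E Γ a , refl }) ∷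
    rule 8 (terms 2) none ((Γᵉ ⊢ᵉ ∼ᵉ x₀) ∷ (Γᵉ ⊢ᵉ x₀) ∷ []) (Γᵉ ⊢ᵉ x₁) (λ { Γ (a , c , _) _ → ∼E Γ a c , refl }) ∷
    rule 9 (terms 1) none ((Γᵉ ⊢ᵉ x₀) ∷ []) (Γᵉ ⊢ᵉ ∼ᵉ ∼ᵉ x₀) (λ { Γ (a , _) _ → ∼∼I Γ a , refl }) ∷
    rule 10 (terms 1) none ((Γᵉ ⊢ᵉ ∼ᵉ ∼ᵉ x₀) ∷ []) (Γᵉ ⊢ᵉ x₀) (λ { Γ (a , _) _ → ∼∼E Γ a , refl }) ∷
    rule 11 (terms 2) none ((Γᵉ ⊢ᵉ x₀) ∷ []) (Γᵉ ⊢ᵉ x₀ ∨ᵉ x₁) (λ { Γ (a , b , _) _ → ∨I₁ Γ a b , refl }) ∷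
    rule 12 (terms 2) none ((Γᵉ ⊢ᵉ x₁) ∷ []) (Γᵉ ⊢ᵉ x₀ ∨ᵉ x₁) (λ { Γ (a , b , _) _ → ∨I₂ Γ a b , refl }) ∷
    rule 13 (terms 2) none ((Γᵉ ⊢ᵉ ∼ᵉ x₀) ∷ (Γᵉ ⊢ᵉ ∼ᵉ x₁) ∷ []) (Γᵉ ⊢ᵉ ∼ᵉ (x₀ ∨ᵉ x₁))
      (λ { Γ (a , b , _) _ → ∼∨I Γ a b , refl }) ∷
    rule 14 (terms 3) none ((Γᵉ ⊢ᵉ x₀ ∨ᵉ x₁) ∷ (x₀ ∷ᵉ Γᵉ ⊢ᵉ x₂) ∷ (x₁ ∷ᵉ Γᵉ ⊢ᵉ x₂) ∷ []) (Γᵉ ⊢ᵉ x₂)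
      (λ { Γ (a , b , c , _) _ → ∨E Γ a b c , refl }) ∷
    rule 15 (terms 2) none ((Γᵉ ⊢ᵉ ∼ᵉ (x₀ ∨ᵉ x₁)) ∷ []) (Γᵉ ⊢ᵉ ∼ᵉ x₀) (λ { Γ (a , b , _) _ → ∼∨E₁ Γ a b , refl }) ∷
    rule 16 (terms 2) none ((Γᵉ ⊢ᵉ ∼ᵉ (x₀ ∨ᵉ x₁)) ∷ []) (Γᵉ ⊢ᵉ ∼ᵉ x₁) (λ { Γ (a , b , _) _ → ∼∨E₂ Γ a b , refl }) ∷
    rule 17 (terms 1) none ((Γᵉ ⊢ᵉ x₀ 𝐍ᵉ) ∷ []) (Γᵉ ⊢ᵉ x₀ ≐ᵉ x₀) (λ { Γ (a , _) _ → 𝐍⇒= Γ a , refl }) ∷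
    rule 18 (terms 1) none ((Γᵉ ⊢ᵉ x₀ ≐ᵉ x₀) ∷ []) (Γᵉ ⊢ᵉ x₀ 𝐍ᵉ) (λ { Γ (a , _) _ → =⇒𝐍 Γ a , refl }) ∷
    rule 19 (terms 2) none ((Γᵉ ⊢ᵉ x₀ ≐ᵉ x₁) ∷ []) (Γᵉ ⊢ᵉ x₁ ≐ᵉ x₀) (λ { Γ (a , b , _) _ → =sym Γ a b , refl }) ∷
    rule 20 (term ∷ term ∷ index ∷ term ∷ []) none
      ((Γᵉ ⊢ᵉ x₀ ≐ᵉ x₁) ∷ (Γᵉ ⊢ᵉ substᵉ #2 x₀ x₃) ∷ []) (Γᵉ ⊢ᵉ substᵉ #2 x₁ x₃)
      (λ { Γ (a , b , i , p , _) _ → =subst Γ a b i p , refl }) ∷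
    rule 21 (terms 2) none ((Γᵉ ⊢ᵉ x₀ ≠ᵉ x₁) ∷ []) (Γᵉ ⊢ᵉ x₁ ≠ᵉ x₀) (λ { Γ (a , b , _) _ → ≠sym Γ a b , refl }) ∷
    rule 22 (terms 2) none ((Γᵉ ⊢ᵉ x₀ 𝐍ᵉ) ∷ (Γᵉ ⊢ᵉ x₁ 𝐍ᵉ) ∷ []) (Γᵉ ⊢ᵉ (x₀ ≐ᵉ x₁) 𝐁ᵉ)
      (λ { Γ (a , b , _) _ → =𝐁I Γ a b , refl }) ∷
    rule 23 (terms 2) none ((Γᵉ ⊢ᵉ (x₀ ≐ᵉ x₁) 𝐁ᵉ) ∷ []) (Γᵉ ⊢ᵉ (x₀ 𝐍ᵉ) ∧ᵉ (x₁ 𝐍ᵉ))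
      (λ { Γ (a , b , _) _ → =𝐁E Γ a b , refl }) ∷
    rule 24 [] none [] (Γᵉ ⊢ᵉ con 𝟎 𝐍ᵉ) (λ { Γ _ _ → 𝟎𝐍 Γ , refl }) ∷
    rule 25 (terms 1) none ((Γᵉ ⊢ᵉ x₀ 𝐍ᵉ) ∷ []) (Γᵉ ⊢ᵉ (𝐒ᵉ x₀) 𝐍ᵉ) (λ { Γ (a , _) _ → 𝐒𝐍I Γ a , refl }) ∷
    rule 26 (terms 1) none ((Γᵉ ⊢ᵉ (𝐒ᵉ x₀) 𝐍ᵉ) ∷ []) (Γᵉ ⊢ᵉ x₀ 𝐍ᵉ) (λ { Γ (a , _) _ → 𝐒𝐍E Γ a , refl }) ∷
    rule 27 (terms 1) none ((Γᵉ ⊢ᵉ x₀ 𝐍ᵉ) ∷ []) (Γᵉ ⊢ᵉ (𝐒ᵉ x₀) ≠ᵉ con 𝟎) (λ { Γ (a , _) _ → 𝐒≠𝟎 Γ a , refl }) ∷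
    rule 28 (terms 2) none ((Γᵉ ⊢ᵉ x₀ ≠ᵉ x₁) ∷ []) (Γᵉ ⊢ᵉ (𝐒ᵉ x₀) ≠ᵉ (𝐒ᵉ x₁)) (λ { Γ (a , b , _) _ → 𝐒≠I Γ a b , refl }) ∷
    rule 29 (terms 2) none ((Γᵉ ⊢ᵉ (𝐒ᵉ x₀) ≠ᵉ (𝐒ᵉ x₁)) ∷ []) (Γᵉ ⊢ᵉ x₀ ≠ᵉ x₁) (λ { Γ (a , b , _) _ → 𝐒≠E Γ a b , refl }) ∷
    rule 30 (terms 2) none ((Γᵉ ⊢ᵉ (𝐒ᵉ x₀) ≐ᵉ (𝐒ᵉ x₁)) ∷ []) (Γᵉ ⊢ᵉ x₀ ≐ᵉ x₁) (λ { Γ (a , b , _) _ → 𝐒=E Γ a b , refl }) ∷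
    rule 31 (terms 1) none ((Γᵉ ⊢ᵉ con bot 𝐍ᵉ) ∷ []) (Γᵉ ⊢ᵉ x₀) (λ { Γ (p , _) _ → bot𝐍E Γ p , refl }) ∷
    rule 32 (term ∷ index ∷ term ∷ []) (fresh #1)
      ((Γᵉ ⊢ᵉ substᵉ #1 (con 𝟎) x₀) ∷ (vᵉ #1 𝐍ᵉ ∷ᵉ x₀ ∷ᵉ Γᵉ ⊢ᵉ substᵉ #1 (𝐒ᵉ vᵉ #1) x₀) ∷ (Γᵉ ⊢ᵉ x₂ 𝐍ᵉ) ∷ [])
      (Γᵉ ⊢ᵉ substᵉ #1 x₂ x₀)
      (λ { Γ (c , i , a , _) notFree → ind Γ c i a notFree , refl }) ∷
    rule 33 (terms 2) (steps #0 #1) ((Γᵉ ⊢ᵉ x₁) ∷ []) (Γᵉ ⊢ᵉ x₀) (λ { Γ (c , c′ , _) r → conv⁻ Γ c c′ r , refl }) ∷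
    rule 34 (terms 2) (steps #0 #1) ((Γᵉ ⊢ᵉ x₀) ∷ []) (Γᵉ ⊢ᵉ x₁) (λ { Γ (c , c′ , _) r → conv⁺ Γ c c′ r , refl }) ∷
    rule 35 (terms 2) (steps #0 #1) ((Γᵉ ⊢ᵉ ∼ᵉ x₀) ∷ []) (Γᵉ ⊢ᵉ ∼ᵉ x₁) (λ { Γ (c , c′ , _) r → conv∼ Γ c c′ r , refl }) ∷
    rule 36 (terms 2) (steps #0 #1) ((Γᵉ ⊢ᵉ x₁ 𝐍ᵉ) ∷ []) (Γᵉ ⊢ᵉ x₀ ≐ᵉ x₁) (λ { Γ (c , c′ , _) r → conv= Γ c c′ r , refl }) ∷
    rule 37 (terms 3) none ((Γᵉ ⊢ᵉ x₂ 𝐍ᵉ) ∷ (Γᵉ ⊢ᵉ (x₁ ·ᵉ x₂ ·ᵉ 𝓡ᵉ x₀ x₁ x₂) 𝐍ᵉ) ∷ [])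
      (Γᵉ ⊢ᵉ 𝓡ᵉ x₀ x₁ (𝐒ᵉ x₂) ≐ᵉ x₁ ·ᵉ x₂ ·ᵉ 𝓡ᵉ x₀ x₁ x₂)
      (λ { Γ (g , h , m , _) _ → 𝓡rec Γ g h m , refl }) ∷
    rule 38 (terms 1) none ((v₀ 𝐍ᵉ ∷ᵉ ↑Γᵉ ⊢ᵉ ↑ᵉ x₀ ·ᵉ v₀) ∷ []) (Γᵉ ⊢ᵉ con 𝓐 ·ᵉ x₀) (λ { Γ (f , _) _ → 𝓐I Γ f , refl }) ∷
    rule 39 (terms 2) none ((Γᵉ ⊢ᵉ con 𝓐 ·ᵉ x₀) ∷ (Γᵉ ⊢ᵉ x₁ 𝐍ᵉ) ∷ []) (Γᵉ ⊢ᵉ x₀ ·ᵉ x₁)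
      (λ { Γ (f , a , _) _ → 𝓐E Γ f a , refl }) ∷
    rule 40 (terms 2) none ((Γᵉ ⊢ᵉ ∼ᵉ (x₀ ·ᵉ x₁)) ∷ (Γᵉ ⊢ᵉ x₁ 𝐍ᵉ) ∷ []) (Γᵉ ⊢ᵉ ∼ᵉ (con 𝓐 ·ᵉ x₀))
      (λ { Γ (f , a , _) _ → ∼𝓐I Γ f a , refl }) ∷
    rule 41 (terms 2) none
      ((Γᵉ ⊢ᵉ ∼ᵉ (con 𝓐 ·ᵉ x₀)) ∷ (v₀ 𝐍ᵉ ∷ᵉ ∼ᵉ (↑ᵉ x₀ ·ᵉ v₀) ∷ᵉ ↑Γᵉ ⊢ᵉ ↑ᵉ x₁) ∷ []) (Γᵉ ⊢ᵉ x₁)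
      (λ { Γ (f , c , _) _ → ∼𝓐E Γ f c , refl }) ∷
    rule 42 (terms 1) none ((Γᵉ ⊢ᵉ con 𝓐 ·ᵉ (ƛᵉ ((↑ᵉ x₀ ·ᵉ v₀) 𝐁ᵉ))) ∷ []) (Γᵉ ⊢ᵉ (con 𝓐 ·ᵉ x₀) 𝐁ᵉ)
      (λ { Γ (u , _) _ → ATI Γ u , refl }) ∷ []

open Rule

-- Premises, conclusion and annotation are indices, so matching a rule with its schema leaves no
-- equations to prove: each clause of `toInstance` holds by computation.
data Instance : List Judgment → Judgment → List ℕ → Set where
  instanceOf : ∀ i → let R = List.lookup rules i in ∀ Γ ρ → Holds (side R) Γ ρ →
    Instance (map (λ J → ⟦ J ⟧ʲ Γ ρ) (premises R)) (⟦ conclusion R ⟧ʲ Γ ρ)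
             (number R ∷ ⌜ Γ ⌝ᶜ ∷ codeEnv (sorts R) ρ)

opaque
  unfolding rules

  toInstance : ∀ {Ps C} (r : Ps ⟹ C) → Instance Ps C (annotation r)
  toInstance (hyp Γ c)          = instanceOf (# 0) Γ (c , _) _
  toInstance (weak Γ a c)       = instanceOf (# 1) Γ (a , c , _) _
  toInstance (cut Γ a c)        = instanceOf (# 2) Γ (a , c , _) _
  toInstance (sub Γ c i s)      = instanceOf (# 3) Γ (c , i , s , _) _
  toInstance (=1I Γ a)          = instanceOf (# 4) Γ (a , _) _
  toInstance (=1E Γ a)          = instanceOf (# 5) Γ (a , _) _
  toInstance (=0I Γ a)          = instanceOf (# 6) Γ (a , _) _
  toInstance (=0E Γ a)          = instanceOf (# 7) Γ (a , _) _
  toInstance (∼E Γ a c)         = instanceOf (# 8) Γ (a , c , _) _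
  toInstance (∼∼I Γ a)          = instanceOf (# 9) Γ (a , _) _
  toInstance (∼∼E Γ a)          = instanceOf (# 10) Γ (a , _) _
  toInstance (∨I₁ Γ a b)        = instanceOf (# 11) Γ (a , b , _) _
  toInstance (∨I₂ Γ a b)        = instanceOf (# 12) Γ (a , b , _) _
  toInstance (∼∨I Γ a b)        = instanceOf (# 13) Γ (a , b , _) _
  toInstance (∨E Γ a b c)       = instanceOf (# 14) Γ (a , b , c , _) _
  toInstance (∼∨E₁ Γ a b)       = instanceOf (# 15) Γ (a , b , _) _
  toInstance (∼∨E₂ Γ a b)       = instanceOf (# 16) Γ (a , b , _) _
  toInstance (𝐍⇒= Γ a)          = instanceOf (# 17) Γ (a , _) _
  toInstance (=⇒𝐍 Γ a)          = instanceOf (# 18) Γ (a , _) _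
  toInstance (=sym Γ a b)       = instanceOf (# 19) Γ (a , b , _) _
  toInstance (=subst Γ a b i p) = instanceOf (# 20) Γ (a , b , i , p , _) _
  toInstance (≠sym Γ a b)       = instanceOf (# 21) Γ (a , b , _) _
  toInstance (=𝐁I Γ a b)        = instanceOf (# 22) Γ (a , b , _) _
  toInstance (=𝐁E Γ a b)        = instanceOf (# 23) Γ (a , b , _) _
  toInstance (𝟎𝐍 Γ)             = instanceOf (# 24) Γ _ _
  toInstance (𝐒𝐍I Γ a)          = instanceOf (# 25) Γ (a , _) _
  toInstance (𝐒𝐍E Γ a)          = instanceOf (# 26) Γ (a , _) _
  toInstance (𝐒≠𝟎 Γ a)          = instanceOf (# 27) Γ (a , _) _
  toInstance (𝐒≠I Γ a b)        = instanceOf (# 28) Γ (a , b , _) _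
  toInstance (𝐒≠E Γ a b)        = instanceOf (# 29) Γ (a , b , _) _
  toInstance (𝐒=E Γ a b)        = instanceOf (# 30) Γ (a , b , _) _
  toInstance (bot𝐍E Γ p)        = instanceOf (# 31) Γ (p , _) _
  toInstance (ind Γ c i a h)    = instanceOf (# 32) Γ (c , i , a , _) h
  toInstance (conv⁻ Γ c c′ r)   = instanceOf (# 33) Γ (c , c′ , _) r
  toInstance (conv⁺ Γ c c′ r)   = instanceOf (# 34) Γ (c , c′ , _) r
  toInstance (conv∼ Γ c c′ r)   = instanceOf (# 35) Γ (c , c′ , _) r
  toInstance (conv= Γ c c′ r)   = instanceOf (# 36) Γ (c , c′ , _) r
  toInstance (𝓡rec Γ g h m)     = instanceOf (# 37) Γ (g , h , m , _) _
  toInstance (𝓐I Γ f)           = instanceOf (# 38) Γ (f , _) _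
  toInstance (𝓐E Γ f a)         = instanceOf (# 39) Γ (f , a , _) _
  toInstance (∼𝓐I Γ f a)        = instanceOf (# 40) Γ (f , a , _) _
  toInstance (∼𝓐E Γ f c)        = instanceOf (# 41) Γ (f , c , _) _
  toInstance (ATI Γ u)          = instanceOf (# 42) Γ (u , _) _

-- Judgments

⌜⌝ᶜ-injective : ∀ {Γ Δ} → ⌜ Γ ⌝ᶜ ≡ ⌜ Δ ⌝ᶜ → Γ ∼[ set ] Δ
⌜⌝ᶜ-injective eq = mk⇔ (transfer eq) (transfer (sym eq))
  where
  transfer : ∀ {Γ Δ t} → ⌜ Γ ⌝ᶜ ≡ ⌜ Δ ⌝ᶜ → t ∈ Γ → t ∈ Δ
  transfer {Γ} {Δ} {t} eq t∈ with u , u∈ , e ← ∈-map⁻ ⌜_⌝ (to (codeSet-injective eq) (∈-map⁺ ⌜_⌝ t∈))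
    with refl ← ⌜⌝-injective {t} {u} e = u∈

-- Set equality of contexts is equality of their codes. Occurrence in a proof and agreement with the
-- conclusion of a rule thereby become comparisons of numbers.
⌜⌝ʲ-≈ : ∀ J K → (J ≈ K) ⇔ (⌜ J ⌝ʲ ≡ ⌜ K ⌝ʲ)
⌜⌝ʲ-≈ (Γ ⊢ c) (Δ ⊢ d) = mk⇔
  (λ { (eq , refl) → cong (⟨_, ⌜ c ⌝ ⟩) (codeSet-cong (∼-map-cong (λ _ → refl) eq)) })
  (λ eq → (λ {_} → ⌜⌝ᶜ-injective {Γ} {Δ} (proj₁ (⟨⟩-injective eq))) , ⌜⌝-injective (proj₂ (⟨⟩-injective eq)))

isCtx : ℕ → Bool
isCtx = all∈ isTerm

isCtx-⌜⌝ᶜ : ∀ Γ → T (isCtx ⌜ Γ ⌝ᶜ)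
isCtx-⌜⌝ᶜ Γ = from (all∈-codeSet isTerm (map ⌜_⌝ Γ)) (All.map⁺ (All.tabulate λ {t} _ → isTerm-⌜⌝ t))

isCtx-sound : ∀ G → T (isCtx G) → ∃[ Γ ] G ≡ ⌜ Γ ⌝ᶜ
isCtx-sound G h = proj₁ (decoded members) , trans (sym (codeSet-elems G)) (cong codeSet (proj₂ (decoded members)))
  where
  decoded : ∀ {xs} → All (T ∘ isTerm) xs → ∃[ Γ ] xs ≡ map ⌜_⌝ Γ
  decoded []        = [] , refl
  decoded (h ∷ hs) with t , refl ← isTerm-sound _ h | Γ , refl ← decoded hs = t ∷ Γ , refl
  members : All (T ∘ isTerm) (elems G)
  members = to (all∈-codeSet isTerm (elems G)) (subst (T ∘ isCtx) (sym (codeSet-elems G)) h)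

-- Lists

nth : ℕ → ℕ → ℕ
nth l k = π₁ (iter π₂ l k)

nth-codeEnv : ∀ ss (ρ : Env ss) → Reads (nth (codeList (codeEnv ss ρ))) ρ
nth-codeEnv (s ∷ ss) (x , ρ) (here refl) = π₁-⟨⟩ _ _
nth-codeEnv (s ∷ ss) (x , ρ) (there i)   =
  trans (cong π₁ (drop-⟨⟩ _ _ (position i))) (nth-codeEnv ss ρ i)

-- Since `nth` returns something for every number and position, reading data proves nothing about
-- their source. Comparing the code of this list with the source forces a well-formed list of the
-- right length.
fields : List Sort → (ℕ → ℕ) → List ℕ
fields []       f = []
fields (s ∷ ss) f = f 0 ∷ fields ss (f ∘ suc)

fields-codeEnv : ∀ ss {f} {ρ : Env ss} → Reads f ρ → fields ss f ≡ codeEnv ss ρ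
fields-codeEnv []       reads = refl
fields-codeEnv (s ∷ ss) reads = cong₂ _∷_ (reads (here refl)) (fields-codeEnv ss (reads ∘ there))

areFields : List Sort → (ℕ → ℕ) → Bool
areFields []           f = true
areFields (term ∷ ss)  f = isTerm (f 0) && areFields ss (f ∘ suc)
areFields (index ∷ ss) f = areFields ss (f ∘ suc)

areFields-complete : ∀ ss {f} {ρ : Env ss} → Reads f ρ → T (areFields ss f)
areFields-complete []           reads = _
areFields-complete (term ∷ ss)  {ρ = t , _} reads =
  from T-∧ (subst (T ∘ isTerm) (sym (reads (here refl))) (isTerm-⌜⌝ t) , areFields-complete ss (reads ∘ there))
areFields-complete (index ∷ ss) reads = areFields-complete ss (reads ∘ there)

areFields-sound : ∀ ss {f} → T (areFields ss f) → Σ[ ρ ∈ Env ss ] Reads f ρ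
areFields-sound [] h = _ , λ ()
areFields-sound (term ∷ ss) h
  with h₀ , hs ← to T-∧ h
  with t , eq ← isTerm-sound _ h₀ | ρ , reads ← areFields-sound ss hs
  = (t , ρ) , λ { (here refl) → sym eq ; (there i) → reads i }
areFields-sound (index ∷ ss) {f} h
  with ρ , reads ← areFields-sound ss h
  = (f 0 , ρ) , λ { (here refl) → refl ; (there i) → reads i }

module _ {n : ℕ} where

  fields-prim : ∀ ss {f : Vec ℕ n → ℕ → ℕ} → (∀ k → Prim (λ xs → f xs k)) →
                Prim (λ xs → codeList (fields ss (f xs)))
  fields-prim []       pf = const-prim 0
  fields-prim (s ∷ ss) pf = ⟨⟩-prim (pf 0) (fields-prim ss (pf ∘ suc))

  areFields-prim : ∀ ss {f : Vec ℕ n → ℕ → ℕ} → (∀ k → Prim (λ xs → f xs k)) →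
                   PrimB (λ xs → areFields ss (f xs))
  areFields-prim []           pf = constB-prim true
  areFields-prim (term ∷ ss)  pf = isTerm-prim (pf 0) &&-prim areFields-prim ss (pf ∘ suc)
  areFields-prim (index ∷ ss) pf = areFields-prim ss (pf ∘ suc)

  any-prim : ∀ {A : Set} {p : Vec ℕ n → A → Bool} → (∀ a → PrimB (λ xs → p xs a)) →
             ∀ as → PrimB (λ xs → any (p xs) as)
  any-prim pp []       = constB-prim false
  any-prim pp (a ∷ as) = pp a ||-prim any-prim pp as

  all-prim : ∀ {A : Set} {p : Vec ℕ n → A → Bool} → (∀ a → PrimB (λ xs → p xs a)) →
             ∀ as → PrimB (λ xs → all (p xs) as)
  all-prim pp []       = constB-prim true
  all-prim pp (a ∷ as) = pp a &&-prim all-prim pp as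

drop-prim : Prim₂ (iter π₂)
drop-prim pl pk = iter-prim pl (π₂-prim var₀) pk

-- Each `π₂` lowers a positive number. A list is therefore no longer than its code, and the code
-- bounds the searches through its entries.
drop≤ : ∀ l k → iter π₂ l k ≤ l ∸ k
drop≤ l zero    = ≤-refl
drop≤ l (suc k) = ≤-trans (π₂≤pred _) (≤-trans (pred-mono-≤ (drop≤ l k)) (≤-reflexive (pred[m∸n]≡m∸[1+n] l k)))

drop-all : ∀ {l k} → l ≤ k → iter π₂ l k ≡ 0
drop-all {l} {k} l≤k = n≤0⇒n≡0 (≤-trans (drop≤ l k) (≤-reflexive (m≤n⇒m∸n≡0 l≤k)))

-- Proofs are lists of entries; the head of an entry is its judgment.
heads : ℕ → ℕ → Bool
heads j l = not (l ≡ᵇ 0) && (π₁ (π₁ l) ≡ᵇ j)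

heads-⟨⟩ : ∀ {j} i a l → T (heads j ⟨ ⟨ i , a ⟩ , l ⟩) ⇔ (i ≡ j)
heads-⟨⟩ {j} i a l rewrite ≡ᵇ-false (⟨⟩≢0 {⟨ i , a ⟩} {l}) | π₁-⟨⟩ ⟨ i , a ⟩ l | π₁-⟨⟩ i a =
  mk⇔ (≡ᵇ⇒≡ i j) (≡⇒≡ᵇ i j)

opaque
  member : ℕ → ℕ → Bool
  member j l = anyBelow (λ k → heads j (iter π₂ l k)) l

  member-prim : PrimB₂ member
  member-prim {g = j} {l} pj pl =
    anyBelow-prim {b = λ ys → heads (j (tail ys)) (iter π₂ (l (tail ys)) (head ys))}
      (not-prim (is-prim 0 dropped) &&-prim ≡ᵇ-prim (π₁-prim (π₁-prim dropped)) (wk pj)) pl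
    where
    dropped : Prim (λ ys → iter π₂ (l (tail ys)) (head ys))
    dropped = drop-prim (wk pl) var₀

  member-∷ : ∀ {j} i a l → T (member j ⟨ ⟨ i , a ⟩ , l ⟩) ⇔ (i ≡ j ⊎ T (member j l))
  member-∷ {j} i a l = mk⇔ sound complete
    where
    sound : T (member j ⟨ ⟨ i , a ⟩ , l ⟩) → i ≡ j ⊎ T (member j l)
    sound h with anyBelow-∃ ⟨ ⟨ i , a ⟩ , l ⟩ h
    ... | zero  , _ , h₀ = inj₁ (to (heads-⟨⟩ i a l) h₀)
    ... | suc k , _ , hs rewrite drop-⟨⟩ ⟨ i , a ⟩ l k with l ≤? k
    -- The bound for the longer list exceeds what `l` allows; the positions beyond hold 0, which
    -- `heads` rejects.
    ...   | yes l≤k = contradiction (subst (T ∘ heads j) (drop-all l≤k) hs) id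
    ...   | no  l≰k = inj₂ (∃-anyBelow (≰⇒> l≰k) hs)
    complete : i ≡ j ⊎ T (member j l) → T (member j ⟨ ⟨ i , a ⟩ , l ⟩)
    complete (inj₁ eq) = ∃-anyBelow (⟨⟩-positive _ _) (from (heads-⟨⟩ i a l) eq)
    complete (inj₂ h) with k , k<l , hk ← anyBelow-∃ l h =
      ∃-anyBelow (≤-<-trans k<l (y<⟨x,y⟩ ⟨ i , a ⟩ l)) (subst (T ∘ heads j) (sym (drop-⟨⟩ ⟨ i , a ⟩ l k)) hk)

  member-[] : ∀ j → ¬ T (member j 0)
  member-[] j ()

member-occursIn : ∀ {Js} (π : Proof Js) J → T (member ⌜ J ⌝ʲ ⌜ π ⌝ᵖ) ⇔ (J occursIn Js)
member-occursIn []               J = mk⇔ (λ h → contradiction h (member-[] ⌜ J ⌝ʲ)) (λ ())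
member-occursIn (step π K r _ _) J = mk⇔
  (λ h → case to (member-∷ _ _ _) h of λ
     { (inj₁ eq) → here (from (⌜⌝ʲ-≈ J K) (sym eq)) ; (inj₂ h′) → there (to (member-occursIn π J) h′) })
  (λ { (here J≈K)  → from (member-∷ _ _ _) (inj₁ (sym (to (⌜⌝ʲ-≈ J K) J≈K)))
     ; (there occ) → from (member-∷ ⌜ K ⌝ʲ _ _) (inj₂ (from (member-occursIn π J) occ)) })

-- The proof checker

-- The entry with judgment j and annotation a follows from the entries in l
-- by the instance of the rule R with context G and environment f.
followsBy : (G : ℕ) (f : ℕ → ℕ) (l j a : ℕ) → Rule → Bool
followsBy G f l j a R =
  (a ≡ᵇ ⟨ number R , ⟨ G , codeList (fields (sorts R) f) ⟩ ⟩) &&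
  isCtx G && areFields (sorts R) f && holds (side R) G f &&
  (j ≡ᵇ codeʲ (conclusion R) G f) &&
  all (λ J → member (codeʲ J G f) l) (premises R)

follows : ℕ → ℕ → ℕ → Rule → Bool
follows l j a = followsBy (π₁ (π₂ a)) (nth (π₂ (π₂ a))) l j a

follows-prim : ∀ {n} {l j a : Vec ℕ n → ℕ} → Prim l → Prim j → Prim a →
               ∀ R → PrimB (λ xs → follows (l xs) (j xs) (a xs) R)
follows-prim pl pj pa R =
  ≡ᵇ-prim pa (⟨⟩-prim (const-prim (number R)) (⟨⟩-prim ctx-prim (fields-prim (sorts R) fld-prim))) &&-prim
  all∈-prim (isTerm-prim var₀) ctx-prim &&-prim
  areFields-prim (sorts R) fld-prim &&-prim
  holds-prim fld-prim ctx-prim (side R) &&-prim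
  ≡ᵇ-prim pj (codeʲ-prim fld-prim ctx-prim (conclusion R)) &&-prim
  all-prim (λ J → member-prim (codeʲ-prim fld-prim ctx-prim J) pl) (premises R)
  where
  ctx-prim = π₁-prim (π₂-prim pa)
  fld-prim = λ k → π₁-prim (drop-prim (π₂-prim (π₂-prim pa)) (const-prim k))

Follows : ℕ → ℕ → ℕ → Rule → Set
Follows l j a R = Σ[ Γ ∈ Ctx ] Σ[ ρ ∈ Env (sorts R) ]
  ( a ≡ codeList (number R ∷ ⌜ Γ ⌝ᶜ ∷ codeEnv (sorts R) ρ)
  × Holds (side R) Γ ρ
  × j ≡ ⌜ ⟦ conclusion R ⟧ʲ Γ ρ ⌝ʲ
  × All (λ J → T (member ⌜ J ⌝ʲ l)) (map (λ J → ⟦ J ⟧ʲ Γ ρ) (premises R)))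

follows-sound : ∀ {l j a} R → T (follows l j a R) → Follows l j a R
follows-sound {l} {j} {a} R h
  with ha , h ← to (T-∧ {a ≡ᵇ _}) h
  with hΓ , h ← to (T-∧ {isCtx (π₁ (π₂ a))}) h
  with hρ , h ← to (T-∧ {areFields (sorts R) _}) h
  with hS , h ← to (T-∧ {holds (side R) _ _}) h
  with hj , hP ← to (T-∧ {j ≡ᵇ _}) h
  with Γ , eqΓ ← isCtx-sound (π₁ (π₂ a)) hΓ | ρ , reads ← areFields-sound (sorts R) hρ
  rewrite eqΓ
  = Γ , ρ
  , trans (≡ᵇ⇒≡ a _ ha) (cong (λ xs → ⟨ number R , ⟨ ⌜ Γ ⌝ᶜ , codeList xs ⟩ ⟩) (fields-codeEnv (sorts R) reads))
  , to (holds-⌜⌝ reads (side R) Γ) hS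
  , trans (≡ᵇ⇒≡ j _ hj) (codeʲ-⌜⌝ reads (conclusion R) Γ)
  , All.map⁺ (All.map (λ {J} → subst (λ c → T (member c l)) (codeʲ-⌜⌝ reads J Γ)) (All.all⁺ _ _ hP))

followsBy-complete : ∀ {f l j a} R Γ {ρ : Env (sorts R)} → Reads f ρ →
  a ≡ codeList (number R ∷ ⌜ Γ ⌝ᶜ ∷ codeEnv (sorts R) ρ) →
  Holds (side R) Γ ρ → j ≡ ⌜ ⟦ conclusion R ⟧ʲ Γ ρ ⌝ʲ →
  All (λ J → T (member ⌜ J ⌝ʲ l)) (map (λ J → ⟦ J ⟧ʲ Γ ρ) (premises R)) →
  T (followsBy ⌜ Γ ⌝ᶜ f l j a R)
followsBy-complete {f} {l} {j} {a} R Γ {ρ} reads eqa hS eqj hP =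
  from (T-∧ {a ≡ᵇ _}) (≡⇒≡ᵇ a _ (trans eqa
    (cong (λ xs → ⟨ number R , ⟨ ⌜ Γ ⌝ᶜ , codeList xs ⟩ ⟩) (sym (fields-codeEnv (sorts R) reads)))) ,
  from (T-∧ {isCtx ⌜ Γ ⌝ᶜ}) (isCtx-⌜⌝ᶜ Γ ,
  from (T-∧ {areFields (sorts R) f}) (areFields-complete (sorts R) reads ,
  from (T-∧ {holds (side R) ⌜ Γ ⌝ᶜ f}) (from (holds-⌜⌝ reads (side R) Γ) hS ,
  from (T-∧ {j ≡ᵇ _}) (≡⇒≡ᵇ j _ (trans eqj (sym (codeʲ-⌜⌝ reads (conclusion R) Γ))) ,
  All.all⁻ (λ J → member (codeʲ J ⌜ Γ ⌝ᶜ f) l)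
    (All.map (λ {J} → subst (λ c → T (member c l)) (sym (codeʲ-⌜⌝ reads J Γ))) (All.map⁻ hP)))))))

follows-complete : ∀ {l j a} R → Follows l j a R → T (follows l j a R)
follows-complete {l} {j} {a} R (Γ , ρ , eqa , hS , eqj , hP)
  rewrite trans (cong π₂ eqa) (π₂-⟨⟩ (number R) ⟨ ⌜ Γ ⌝ᶜ , codeList (codeEnv (sorts R) ρ) ⟩)
        | π₁-⟨⟩ ⌜ Γ ⌝ᶜ (codeList (codeEnv (sorts R) ρ))
        | π₂-⟨⟩ ⌜ Γ ⌝ᶜ (codeList (codeEnv (sorts R) ρ))
  = followsBy-complete R Γ (nth-codeEnv (sorts R) ρ) eqa hS eqj hP

opaque
  justified : ℕ → ℕ → Bool
  justified l e = (e ≡ᵇ ⟨ π₁ e , π₂ e ⟩) && any (follows l (π₁ e) (π₂ e)) rules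

  justified-prim : PrimB₂ justified
  justified-prim pl pe = ≡ᵇ-prim pe (⟨⟩-prim (π₁-prim pe) (π₂-prim pe)) &&-prim
    any-prim (follows-prim pl (π₁-prim pe) (π₂-prim pe)) rules

  justified-sound : ∀ {Js} (π : Proof Js) e → T (justified ⌜ π ⌝ᵖ e) →
                    ∃[ J ] Σ[ π′ ∈ Proof (J ∷ Js) ] ⌜ π′ ⌝ᵖ ≡ ⟨ e , ⌜ π ⌝ᵖ ⟩
  justified-sound π e h
    with he , hR ← to (T-∧ {e ≡ᵇ _}) h
    with R , _ , hR ← find (Any.any⁻ _ rules hR)
    with Γ , ρ , eqa , hS , eqj , hP ← follows-sound R hR
    with r , eqr ← derive R Γ ρ hS
    -- The code of the entry fixes its judgment only up to `≈`, so the conclusion of the instance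
    -- itself serves as the entry.
    = ⟦ conclusion R ⟧ʲ Γ ρ
    , step π _ r (from (⌜⌝ʲ-≈ _ _) refl) (All.map (λ {J} → to (member-occursIn π J)) hP)
    , cong (⟨_, ⌜ π ⌝ᵖ ⟩) (trans (cong₂ ⟨_,_⟩ (sym eqj) (trans (cong codeList eqr) (sym eqa))) (sym (≡ᵇ⇒≡ e _ he)))

  justified-complete : ∀ {Js Ps C} (π : Proof Js) J (r : Ps ⟹ C) → J ≈ C → All (_occursIn Js) Ps →
                       T (justified ⌜ π ⌝ᵖ ⟨ ⌜ J ⌝ʲ , codeList (annotation r) ⟩)
  justified-complete {Js} π J r J≈C occ
    rewrite π₁-⟨⟩ ⌜ J ⌝ʲ (codeList (annotation r)) | π₂-⟨⟩ ⌜ J ⌝ʲ (codeList (annotation r))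
    = from (T-∧ {⟨ ⌜ J ⌝ʲ , codeList (annotation r) ⟩ ≡ᵇ _}) (≡⇒≡ᵇ ⟨ ⌜ J ⌝ʲ , codeList (annotation r) ⟩ _ refl , accepted (toInstance r) J≈C occ)
    where
    accepted : ∀ {Ps C as} → Instance Ps C as → J ≈ C → All (_occursIn Js) Ps →
               T (any (follows ⌜ π ⌝ᵖ ⌜ J ⌝ʲ (codeList as)) rules)
    accepted {as = as} (instanceOf i Γ ρ hS) J≈C occ = Any.any⁺ (follows ⌜ π ⌝ᵖ ⌜ J ⌝ʲ (codeList as)) (lose (∈-lookup {xs = rules} i)
      (follows-complete (List.lookup rules i)
        (Γ , ρ , refl , hS , to (⌜⌝ʲ-≈ J _) J≈C , All.map (λ {K} → from (member-occursIn π K)) occ)))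

-- The value 0 is accepted because positions past the end of a list hold it. The comparison with the
-- reassembled pair rejects tails that are neither 0 nor pairs.
isStep : ℕ → Bool
isStep l = (l ≡ᵇ 0) || ((l ≡ᵇ ⟨ π₁ l , π₂ l ⟩) && justified (π₂ l) (π₁ l))

-- With the latest entry first, a suffix consists of an entry followed by exactly those it may cite.
-- Suffixes can be checked independently, so a bounded quantifier replaces a recursion along the
-- proof.
isProof : ℕ → Bool
isProof p = allBelow (λ k → isStep (iter π₂ p k)) p

isProof-prim : ∀ {n} {p : Vec ℕ n → ℕ} → Prim p → PrimB (λ xs → isProof (p xs))
isProof-prim {p = p} pp = allBelow-prim {b = λ ys → isStep (iter π₂ (p (tail ys)) (head ys))}
  (is-prim 0 dropped ||-prim
   (≡ᵇ-prim dropped (⟨⟩-prim (π₁-prim dropped) (π₂-prim dropped)) &&-prim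
    justified-prim (π₂-prim dropped) (π₁-prim dropped))) pp
  where
  dropped : Prim (λ ys → iter π₂ (p (tail ys)) (head ys))
  dropped = drop-prim (wk pp) var₀

isProof-∷ : ∀ e l → T (isProof ⟨ e , l ⟩) ⇔ (T (justified l e) × T (isProof l))
isProof-∷ e l = mk⇔ sound complete
  where
  isStep-⟨⟩ : T (isStep ⟨ e , l ⟩) ⇔ T (justified l e)
  isStep-⟨⟩ rewrite ≡ᵇ-false (⟨⟩≢0 {e} {l}) | π₁-⟨⟩ e l | π₂-⟨⟩ e l | ≡ᵇ-true {⟨ e , l ⟩} refl = mk⇔ id id
  sound : T (isProof ⟨ e , l ⟩) → T (justified l e) × T (isProof l)
  sound h = to isStep-⟨⟩ (allBelow-∀ h (⟨⟩-positive e l))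
          , ∀-allBelow l λ {k} k<l → subst (T ∘ isStep) (drop-⟨⟩ e l k)
                                       (allBelow-∀ h (≤-<-trans k<l (y<⟨x,y⟩ e l)))
  complete : T (justified l e) × T (isProof l) → T (isProof ⟨ e , l ⟩)
  complete (he , hl) = ∀-allBelow ⟨ e , l ⟩ at
    where
    at : ∀ {k} → k < ⟨ e , l ⟩ → T (isStep (iter π₂ ⟨ e , l ⟩ k))
    at {zero}  _ = from isStep-⟨⟩ he
    at {suc k} _ rewrite drop-⟨⟩ e l k with l ≤? k
    ... | yes l≤k rewrite drop-all l≤k = _
    ... | no  l≰k = allBelow-∀ hl (≰⇒> l≰k)

isProof-complete : ∀ {Js} (π : Proof Js) → T (isProof ⌜ π ⌝ᵖ)
isProof-complete [] = _
isProof-complete (step π J r J≈C occ) =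
  from (isProof-∷ _ _) (justified-complete π J r J≈C occ , isProof-complete π)

isProof-sound : ∀ p → T (isProof p) → ∃[ Js ] Σ[ π ∈ Proof Js ] ⌜ π ⌝ᵖ ≡ p
isProof-sound = <-rec _ decoded
  where
  decoded : ∀ p → (∀ {q} → q < p → T (isProof q) → ∃[ Js ] Σ[ π ∈ Proof Js ] ⌜ π ⌝ᵖ ≡ q) →
            T (isProof p) → ∃[ Js ] Σ[ π ∈ Proof Js ] ⌜ π ⌝ᵖ ≡ p
  decoded zero      ih h = [] , [] , refl
  decoded p@(suc _) ih h
    -- The check at position 0: as `p` is positive, it can only have passed as a pair.
    with eq ← ≡ᵇ⇒≡ p ⟨ π₁ p , π₂ p ⟩ (proj₁ (to T-∧ (allBelow-∀ {k = p} h z<s)))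
    with he , hl ← to (isProof-∷ (π₁ p) (π₂ p)) (subst (T ∘ isProof) eq h)
    with Js , π , eqπ ← ih (π₂< z<s) hl
    with J , π′ , eqπ′ ← justified-sound π (π₁ p) (subst (λ l → T (justified l (π₁ p))) (sym eqπ) he)
    = J ∷ Js , π′ , trans eqπ′ (trans (cong (⟨ π₁ p ,_⟩) eqπ) (sym eq))

-- Here `j` is an arbitrary number; it is the code of a judgment because an entry of a valid proof
-- carries it.
member-decode : ∀ {Js j} (π : Proof Js) → T (member j ⌜ π ⌝ᵖ) → ∃[ J ] (⌜ J ⌝ʲ ≡ j × J occursIn Js)
member-decode {j = j} [] h = contradiction h (member-[] j)
member-decode (step π J r _ _) h with to (member-∷ _ _ _) h
... | inj₁ eq = J , eq , here (from (⌜⌝ʲ-≈ J J) refl)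
... | inj₂ h′ with K , eq , occ ← member-decode π h′ = K , eq , there occ

-- The proof predicate.

opaque
  proves : ℕ → ℕ → Bool
  proves p j = isProof p && member j p

  proves-prim : PrimB₂ proves
  proves-prim pp pj = isProof-prim pp &&-prim member-prim pj pp

  proves-ProvesCode : ∀ p j → T (proves p j) ⇔ ProvesCode p j
  proves-ProvesCode p j = mk⇔ sound
    λ { (Js , π , refl , J , refl , occ) → from T-∧ (isProof-complete π , from (member-occursIn π J) occ) }
    where
    sound : T (proves p j) → ProvesCode p j
    sound h with hp , hj ← to T-∧ h with Js , π , refl ← isProof-sound p hp = Js , π , refl , member-decode π hj

theorem6p1 : RecursivelyEnumerable DerivableCode
    × (Σ[ P ∈ (ℕ → ℕ → ℕ) ]
    ( PrimitiveRecursive₂ P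
    × (∀ p j → (P p j ≡ 0) ⊎ (P p j ≡ 1))
    × (∀ p j → (P p j ≡ 1) ⇔ ProvesCode p j)
    × (∀ j → DerivableCode j ⇔ (∃[ p ] P p j ≡ 1))))
theorem6p1 = (P , P-prim , derivable) , P , P-prim , (λ p j → χ-01 (proves p j)) , correct , derivable
  where
  P : ℕ → ℕ → ℕ
  P p j = χ (proves p j)
  P-prim : PrimitiveRecursive₂ P
  P-prim with prim c cc ← PrimB.indicator (proves-prim var₀ (wk {n = 1} var₀)) = c , λ p j → cc (p ∷ j ∷ [])
  χ-01 : ∀ b → (χ b ≡ 0) ⊎ (χ b ≡ 1)
  χ-01 true  = inj₂ refl
  χ-01 false = inj₁ refl
  χ-T : ∀ b → (χ b ≡ 1) ⇔ T b
  χ-T true  = mk⇔ _ (λ _ → refl)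
  χ-T false = mk⇔ (λ ()) (λ ())
  correct : ∀ p j → (P p j ≡ 1) ⇔ ProvesCode p j
  correct p j = mk⇔ (to (proves-ProvesCode p j) ∘ to (χ-T (proves p j)))
                    (from (χ-T (proves p j)) ∘ from (proves-ProvesCode p j))
  derivable : ∀ j → DerivableCode j ⇔ (∃[ p ] P p j ≡ 1)
  derivable j = mk⇔
    (λ { (J , eq , Js , π , occ) → ⌜ π ⌝ᵖ , from (correct _ j) (Js , π , refl , J , eq , occ) })
    λ { (p , eq) → derive′ p (to (correct p j) eq) }
    where
    derive′ : ∀ p → ProvesCode p j → DerivableCode j
    derive′ p (Js , π , _ , J , eqJ , occ) = J , eqJ , Js , π , occ
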